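{- Let $q=p^k$ be a prime power with $p\neq 2,3$. Then the projective norm graph $\mathrm{NG}(q,4)$ contains at least $(q^3-1)(q-1)(q^3-24)$ (distinct) subgraphs isomorphic to $K_{4,6}$, i.e. sets consisting of $4+6$ distinct vertices such that each of the $4$ vertices is adjacent to each of the $6$ vertices.
   Context: $N:\mathbb{F}_{q^{3}}\to\mathbb{F}_q$ denotes the norm $N(A)=A^{1+q+q^2}$. The projective norm graph $\mathrm{NG}(q,4)$ has vertex set $\mathbb{F}_{q^{3}}\times\mathbb{F}_q^*$, and distinct vertices $(A,a)$, $(B,b)$ are adjacent iff $N(A+B)=ab$. -}

module Defs where

open import Level using (0ℓ)
open import Algebra.Bundles using (CommutativeRing)
open import Data.Nat using (ℕ; zero; suc)
import Data.Nat as ℕ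
open import Data.Fin using (Fin)
open import Data.Product using (Σ; ∃; _×_; _,_; proj₁; proj₂)
open import Relation.Nullary using (¬_)
open import Relation.Binary.PropositionalEquality using (_≡_; _≢_)

record FiniteField (n : ℕ) : Set₁ where
  field
    cring : CommutativeRing 0ℓ 0ℓ
  open CommutativeRing cring public
  field
    0≉1    : ¬ (0# ≈ 1#)
    inv    : ∀ x → ¬ (x ≈ 0#) → ∃ λ y → x * y ≈ 1#
    enum   : Fin n → Carrier
    enum-injective  : ∀ i j → enum i ≈ enum j → i ≡ j
    enum-surjective : ∀ x → ∃ λ i → enum i ≈ x

module NormGraph (q : ℕ) (F : FiniteField (q ℕ.^ 3)) where
  open FiniteField F

  pow : Carrier → ℕ → Carrier
  pow x zero    = 1#
  pow x (suc n) = x * pow x n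

  -- F_q is the subfield {a | a^q = a} of F = F_{q^3}; F_q^* its nonzero part
  InFq* : Carrier → Set
  InFq* a = (pow a q ≈ a) × ¬ (a ≈ 0#)

  -- norm N : F_{q^3} → F_q, N(A) = A^(1+q+q^2)
  N : Carrier → Carrier
  N A = pow A (1 ℕ.+ q ℕ.+ q ℕ.* q)

  Vertex : Set
  Vertex = Carrier × Σ Carrier InFq*

  _≃_ : Vertex → Vertex → Set
  (A , (a , _)) ≃ (B , (b , _)) = (A ≈ B) × (a ≈ b)

  Adj : Vertex → Vertex → Set
  Adj u v = ¬ (u ≃ v) × (N (proj₁ u + proj₁ v)
                          ≈ proj₁ (proj₂ u) * proj₁ (proj₂ v))

  record K46 : Set where
    field
      S : Fin 4 → Vertex
      T : Fin 6 → Vertex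
      S-distinct  : ∀ i j → i ≢ j → ¬ (S i ≃ S j)
      T-distinct  : ∀ i j → i ≢ j → ¬ (T i ≃ T j)
      ST-distinct : ∀ i j → ¬ (S i ≃ T j)
      complete    : ∀ i j → Adj (S i) (T j)

  -- two copies are the same subgraph iff they have the same 4-set and the
  -- same 6-set (the sides are distinguished by their sizes)
  SameK46 : K46 → K46 → Set
  SameK46 G H =
    (∀ i → ∃ λ j → K46.S G i ≃ K46.S H j) × (∀ j → ∃ λ i → K46.S H j ≃ K46.S G i) ×
    (∀ i → ∃ λ j → K46.T G i ≃ K46.T H j) × (∀ j → ∃ λ i → K46.T H j ≃ K46.T G i)

  AtLeastK46 : ℕ → Set
  AtLeastK46 m = Σ (Fin m → K46) λ f → ∀ i j → SameK46 (f i) (f j) → i ≡ j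

-- Let s be the Frobenius x ↦ x^q of the field F of q³ elements, so that N x = x · s x · s² x.
-- Take a of trace zero with k = a² + ab + b² ≠ 0, where b = s a and c = s b, and put
-- x = a(c - b), y = b(a - c), z = c(b - a).  Then s permutes x, y, z cyclically, x + y + z = 0,
-- xy + yz + zx = -k² and s k = k.  The six points
--   y,  y ± k,  zx / y,  x(z - y) / (y - x),  z(y - x) / (z - y)
-- have norm w = xyz, and adding x or z to any of them gives norm -w; this is a copy of K_{3,6}
-- to which the point at infinity belongs as a fourth centre.  The inversion X ↦ 1 / (X + e)
-- moves it to 0 and produces centres A_i and points B_j with N(A_i + B_j) = a_i b_j.
-- Translating the A_i by d and the B_j by -d, with d ≠ (B_j - A_i) / 2, then scaling by an element
-- of F*, and multiplying the two kinds of weight by t and 1/t for t ∈ F_q*, gives the copies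
-- counted.  They are distinct: 3 Σ A_i + 2 Σ B_j is unaffected by d and, for a suitable e,
-- nonzero, so it recovers the scale; then Σ A_i recovers d, and a single weight recovers t.
module Submission where

open import Defs
open import Level using (0ℓ)
open import Algebra.Bundles using (CommutativeRing; CommutativeMonoid)
import Algebra.Properties.CommutativeMonoid.Sum as Sum
import Algebra.Solver.Ring as RingSolver
open import Algebra.Solver.Ring.AlmostCommutativeRing
  using (fromCommutativeRing; _-Raw-AlmostCommutative⟶_)
open import Algebra.Structures using (IsCommutativeMonoid)
open import Data.Fin as Fin using (Fin; zero; suc; toℕ; fromℕ; inject₁; _↑ˡ_; _↑ʳ_; combine; remQuot)
open import Data.Fin.Patterns using (0F; 1F; 2F; 3F; 4F; 5F)
open import Data.Fin.Permutation using (Permutation; permutation)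
import Data.Fin.Properties as Finₚ
open import Data.Integer as ℤ using (ℤ; +_; -[1+_]; _⊖_; 0ℤ; 1ℤ)
import Data.Integer.Properties as ℤₚ
open import Data.List using (List; []; _∷_; length)
open import Data.Maybe using (Maybe; just; nothing)
open import Data.Nat as ℕ using (ℕ; zero; suc; s≤s; z≤n)
open import Data.Nat.Combinatorics using (_C_; nC1≡n; nCn≡1; nCk+nC[k+1]≡[n+1]C[k+1])
open import Data.Nat.Coprimality using (Coprime; coprime-Bézout)
open import Data.Nat.Divisibility as ∣ using (_∣_)
open import Data.Nat.GCD using (module Bézout)
open import Data.Nat.Primality
  using (Prime; euclidsLemma; prime?; prime[2]; prime⇒irreducible; ¬prime[0]; ¬prime[1])
import Data.Nat.Properties as ℕₚ
open import Data.Nat.Tactic.RingSolver using (solve-∀)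
open import Data.Product using (∃; _×_; _,_; proj₁; proj₂)
open import Data.Sum using (inj₁; inj₂)
open import Data.Vec using (Vec; []; _∷_)
open import Data.Vec.Functional using (_++_)
open import Data.Vec.Functional.Properties using (lookup-++ˡ; lookup-++ʳ)
open import Function using (_∘_)
open import Relation.Binary using (tri<; tri≈; tri>)
open import Relation.Binary.PropositionalEquality as ≡ using (_≡_; _≢_)
open import Relation.Nullary using (¬_; Dec; yes; no; contradiction)
open import Relation.Nullary.Decidable using (map′; from-yes)

-- Binomial coefficients modulo a prime.

[1+k]*[1+n]C[1+k]≡[1+n]*nCk : ∀ n k → suc k ℕ.* (suc n C suc k) ≡ suc n ℕ.* (n C k)
[1+k]*[1+n]C[1+k]≡[1+n]*nCk n zero =
  ≡.trans (ℕₚ.*-identityˡ _) (≡.trans (nC1≡n (suc n)) (≡.sym (ℕₚ.*-identityʳ _)))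
[1+k]*[1+n]C[1+k]≡[1+n]*nCk zero (suc k) = ℕₚ.*-zeroʳ (suc (suc k))
[1+k]*[1+n]C[1+k]≡[1+n]*nCk (suc n) (suc k) = begin
  suc (suc k) ℕ.* (suc (suc n) C suc (suc k))
    ≡⟨ ≡.cong (suc (suc k) ℕ.*_) (≡.sym (nCk+nC[k+1]≡[n+1]C[k+1] (suc n) (suc k))) ⟩
  suc (suc k) ℕ.* (c ℕ.+ (suc n C suc (suc k)))
    ≡⟨ ℕₚ.*-distribˡ-+ (suc (suc k)) c _ ⟩
  (c ℕ.+ suc k ℕ.* c) ℕ.+ suc (suc k) ℕ.* (suc n C suc (suc k))
    ≡⟨ ≡.cong₂ (λ u v → (c ℕ.+ u) ℕ.+ v) ([1+k]*[1+n]C[1+k]≡[1+n]*nCk n k)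
         ([1+k]*[1+n]C[1+k]≡[1+n]*nCk n (suc k)) ⟩
  (c ℕ.+ suc n ℕ.* (n C k)) ℕ.+ suc n ℕ.* (n C suc k)
    ≡⟨ ℕₚ.+-assoc c _ _ ⟩
  c ℕ.+ (suc n ℕ.* (n C k) ℕ.+ suc n ℕ.* (n C suc k))
    ≡⟨ ≡.cong (c ℕ.+_) (≡.sym (ℕₚ.*-distribˡ-+ (suc n) (n C k) (n C suc k))) ⟩
  c ℕ.+ suc n ℕ.* ((n C k) ℕ.+ (n C suc k))
    ≡⟨ ≡.cong (λ u → c ℕ.+ suc n ℕ.* u) (nCk+nC[k+1]≡[n+1]C[k+1] n k) ⟩
  suc (suc n) ℕ.* c ∎
  where
  open ≡.≡-Reasoning
  c = suc n C suc k

-- By the absorption identity the prime divides `suc k` times the coefficient. It is too large to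
-- divide `suc k`, so Euclid's lemma leaves the coefficient.
prime∣pCk : ∀ {p} k → Prime (suc p) → k ℕ.< p → suc p ∣ (suc p C suc k)
prime∣pCk {p} k pr k<p
  with euclidsLemma (suc k) (suc p C suc k) pr
         (≡.subst (suc p ∣_) (≡.sym ([1+k]*[1+n]C[1+k]≡[1+n]*nCk p k)) (∣.m∣m*n (p C k)))
... | inj₁ p∣k = contradiction p∣k (∣.>⇒∤ (s≤s k<p))
... | inj₂ p∣C = p∣C

-- A ring solver with integer coefficients.

module IntegerSolver (R : CommutativeRing 0ℓ 0ℓ) where
  open CommutativeRing R hiding (zero)
  open import Algebra.Properties.Ring ring using (-‿distribˡ-*; -‿distribʳ-*; -0#≈0#; -‿involutive)
  open import Algebra.Properties.AbelianGroup +-abelianGroup using (⁻¹-∙-comm)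
  open import Algebra.Properties.Semiring.Mult.TCOptimised semiring
    using (1+×; ×-homo-+; ×1-homo-*) renaming (_×_ to _×ₙ_)
  open import Relation.Binary.Reasoning.Setoid setoid

  -- With the optimised multiple, `fromℤ 1ℤ` reduces to `1#`, so that `con 1ℤ` in a solver
  -- expression is literally `1#`.
  fromℤ : ℤ → Carrier
  fromℤ (+ n)      = n ×ₙ 1#
  fromℤ (-[1+ n ]) = - (suc n ×ₙ 1#)

  fromℤ-neg : ∀ i → fromℤ (ℤ.- i) ≈ - fromℤ i
  fromℤ-neg (+ zero)   = sym -0#≈0#
  fromℤ-neg (+ suc n)  = refl
  fromℤ-neg (-[1+ n ]) = sym (-‿involutive _)

  cancel-1 : ∀ a b → (1# + a) - (1# + b) ≈ a - b
  cancel-1 a b = begin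
    (1# + a) - (1# + b)     ≈⟨ +-cong (+-comm a 1#) (⁻¹-∙-comm 1# b) ⟨
    (a + 1#) + (- 1# - b)   ≈⟨ +-assoc a 1# _ ⟩
    a + (1# + (- 1# - b))   ≈⟨ +-congˡ (+-assoc 1# (- 1#) (- b)) ⟨
    a + ((1# - 1#) - b)     ≈⟨ +-congˡ (trans (+-congʳ (-‿inverseʳ 1#)) (+-identityˡ _)) ⟩
    a - b                   ∎

  fromℤ-⊖ : ∀ m n → fromℤ (m ⊖ n) ≈ m ×ₙ 1# - n ×ₙ 1#
  fromℤ-⊖ m zero = trans (reflexive (≡.cong fromℤ (ℤₚ.⊖-≥ {m} z≤n)))
    (sym (trans (+-congˡ -0#≈0#) (+-identityʳ _)))
  fromℤ-⊖ zero (suc n) = sym (+-identityˡ _)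
  fromℤ-⊖ (suc m) (suc n) = begin
    fromℤ (suc m ⊖ suc n)             ≡⟨ ≡.cong fromℤ (ℤₚ.[1+m]⊖[1+n]≡m⊖n m n) ⟩
    fromℤ (m ⊖ n)                     ≈⟨ fromℤ-⊖ m n ⟩
    m ×ₙ 1# - n ×ₙ 1#                   ≈⟨ cancel-1 _ _ ⟨
    (1# + m ×ₙ 1#) - (1# + n ×ₙ 1#)     ≈⟨ +-cong (1+× m 1#) (-‿cong (1+× n 1#)) ⟨
    suc m ×ₙ 1# - suc n ×ₙ 1#           ∎

  fromℤ-+ : ∀ i j → fromℤ (i ℤ.+ j) ≈ fromℤ i + fromℤ j
  fromℤ-+ (+ m) (+ n)           = ×-homo-+ 1# m n
  fromℤ-+ (+ m) (-[1+ n ])      = fromℤ-⊖ m (suc n)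
  fromℤ-+ (-[1+ m ]) (+ n)      = trans (fromℤ-⊖ n (suc m)) (+-comm _ _)
  fromℤ-+ (-[1+ m ]) (-[1+ n ]) = begin
    - (suc (suc (m ℕ.+ n)) ×ₙ 1#)      ≡⟨ ≡.cong (λ k → - (k ×ₙ 1#)) (ℕₚ.+-suc (suc m) n) ⟨
    - ((suc m ℕ.+ suc n) ×ₙ 1#)        ≈⟨ -‿cong (×-homo-+ 1# (suc m) (suc n)) ⟩
    - (suc m ×ₙ 1# + suc n ×ₙ 1#)       ≈⟨ ⁻¹-∙-comm _ _ ⟨
    - (suc m ×ₙ 1#) - suc n ×ₙ 1#       ∎

  fromℤ-*⁺ : ∀ m j → fromℤ (+ m ℤ.* j) ≈ fromℤ (+ m) * fromℤ j
  fromℤ-*⁺ m (+ n) = trans (reflexive (≡.cong fromℤ (≡.sym (ℤₚ.pos-* m n)))) (×1-homo-* m n)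
  fromℤ-*⁺ m (-[1+ n ]) = begin
    fromℤ (+ m ℤ.* -[1+ n ])          ≡⟨ ≡.cong fromℤ (ℤₚ.neg-distribʳ-* (+ m) (+ suc n)) ⟨
    fromℤ (ℤ.- (+ m ℤ.* + suc n))     ≈⟨ fromℤ-neg (+ m ℤ.* + suc n) ⟩
    - fromℤ (+ m ℤ.* + suc n)         ≈⟨ -‿cong (fromℤ-*⁺ m (+ suc n)) ⟩
    - (m ×ₙ 1# * suc n ×ₙ 1#)           ≈⟨ -‿distribʳ-* _ _ ⟩
    m ×ₙ 1# * - (suc n ×ₙ 1#)           ∎

  fromℤ-* : ∀ i j → fromℤ (i ℤ.* j) ≈ fromℤ i * fromℤ j
  fromℤ-* (+ m) j = fromℤ-*⁺ m j
  fromℤ-* (-[1+ m ]) j = begin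
    fromℤ (-[1+ m ] ℤ.* j)            ≡⟨ ≡.cong fromℤ (ℤₚ.neg-distribˡ-* (+ suc m) j) ⟨
    fromℤ (ℤ.- (+ suc m ℤ.* j))       ≈⟨ fromℤ-neg (+ suc m ℤ.* j) ⟩
    - fromℤ (+ suc m ℤ.* j)           ≈⟨ -‿cong (fromℤ-*⁺ (suc m) j) ⟩
    - (suc m ×ₙ 1# * fromℤ j)          ≈⟨ -‿distribˡ-* _ _ ⟩
    - (suc m ×ₙ 1#) * fromℤ j          ∎

  morphism : ℤ.+-*-rawRing -Raw-AlmostCommutative⟶ fromCommutativeRing R
  morphism = record
    { ⟦_⟧ = fromℤ ; +-homo = fromℤ-+ ; *-homo = fromℤ-* ; -‿homo = fromℤ-neg
    ; 0-homo = refl ; 1-homo = refl }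

  -- A one-sided test: in positive characteristic distinct integers can have equal images.
  decide : ∀ i j → Maybe (fromℤ i ≈ fromℤ j)
  decide i j with i ℤ.≟ j
  ... | yes i≡j = just (reflexive (≡.cong fromℤ i≡j))
  ... | no  _   = nothing

  open RingSolver ℤ.+-*-rawRing (fromCommutativeRing R) morphism decide public
    using (Polynomial; con; var; op; [+]; [*]; _:+_; _:*_; _:-_; :-_; _:^_; _:=_; solve; prove; ⟦_⟧; ⟦_⟧↓)

-- Additivity of the Frobenius map.

module Frobenius (R : CommutativeRing 0ℓ 0ℓ) where
  open CommutativeRing R hiding (zero)
  open import Algebra.Properties.Semiring.Exp semiring using (_^_)
  open import Algebra.Properties.Semiring.Mult semiring using (×-assocˡ; ×-congʳ; ×-congˡ; ×-assoc-*)
    renaming (_×_ to _×ₙ_)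
  open import Algebra.Properties.Monoid.Sum +-monoid using (sum; sum-init-last; sum-cong-≋; sum-replicate-zero)
  open import Algebra.Properties.CommutativeSemiring.Binomial commutativeSemiring
    using (binomialTerm; theorem)
  open import Relation.Binary.Reasoning.Setoid setoid

  -- In the binomial expansion every term except the two outer ones has a coefficient divisible by
  -- `p`.
  frobenius-+ : ∀ {p} → Prime p → p ×ₙ 1# ≈ 0# → ∀ x y → (x + y) ^ p ≈ x ^ p + y ^ p
  frobenius-+ {suc p} pr p×1≈0 x y = begin
    (x + y) ^ suc p                                      ≈⟨ theorem (suc p) x y ⟩
    t zero + sum (λ k → t (suc k))                       ≈⟨ +-congˡ (sum-init-last (λ k → t (suc k))) ⟩
    t zero + (sum (λ k → t (suc (inject₁ k))) + t (suc (fromℕ p)))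
      ≈⟨ +-cong first (+-cong (trans (sum-cong-≋ middle) (sum-replicate-zero p)) last′) ⟩
    y ^ suc p + (0# + x ^ suc p)                         ≈⟨ +-congˡ (+-identityˡ _) ⟩
    y ^ suc p + x ^ suc p                                ≈⟨ +-comm _ _ ⟩
    x ^ suc p + y ^ suc p                                ∎
    where
    t = binomialTerm x y (suc p)

    first : t zero ≈ y ^ suc p
    first = trans (+-identityʳ _) (*-identityˡ _)

    p×≈0 : ∀ z → suc p ×ₙ z ≈ 0#
    p×≈0 z = begin
      suc p ×ₙ z         ≈⟨ ×-congʳ (suc p) (*-identityˡ z) ⟨
      suc p ×ₙ (1# * z)  ≈⟨ ×-assoc-* (suc p) 1# z ⟨
      (suc p ×ₙ 1#) * z  ≈⟨ *-congʳ p×1≈0 ⟩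
      0# * z            ≈⟨ zeroˡ z ⟩
      0#                ∎

    middle : ∀ k → t (suc (inject₁ k)) ≈ 0#
    middle k with prime∣pCk (toℕ (inject₁ k)) pr
                    (≡.subst (ℕ._< p) (≡.sym (Finₚ.toℕ-inject₁ k)) (Finₚ.toℕ<n k))
    ... | ∣.divides m eq = begin
      (suc p C toℕ (suc (inject₁ k))) ×ₙ u  ≈⟨ ×-congˡ (≡.trans eq (ℕₚ.*-comm m (suc p))) ⟩
      (suc p ℕ.* m) ×ₙ u                    ≈⟨ ×-assocˡ u (suc p) m ⟨
      suc p ×ₙ (m ×ₙ u)                      ≈⟨ p×≈0 _ ⟩
      0#                                   ∎
      where u = x ^ toℕ (suc (inject₁ k)) * y ^ (suc p ℕ.∸ toℕ (suc (inject₁ k)))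

    last′ : t (suc (fromℕ p)) ≈ x ^ suc p
    last′ rewrite Finₚ.toℕ-fromℕ p | nCn≡1 (suc p) | ℕₚ.n∸n≡0 p =
      trans (+-identityʳ _) (*-identityʳ _)

-- Arithmetic in a finite field.

module FieldProperties {n : ℕ} (F : FiniteField n) where
  open FiniteField F hiding (zero)
  open IntegerSolver cring
  open import Algebra.Properties.Semiring.Exp semiring using (_^_; ^-congˡ)
  open import Algebra.Properties.Semiring.Mult semiring using () renaming (_×_ to _·_)
  open import Algebra.Properties.Ring ring using (x∙y⁻¹≈ε⇒x≈y; x≈y⇒x∙y⁻¹≈ε)
  open import Relation.Binary.Reasoning.Setoid setoid

  index : Carrier → Fin n
  index x = proj₁ (enum-surjective x)

  enum-index : ∀ x → enum (index x) ≈ x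
  enum-index x = proj₂ (enum-surjective x)

  -- As `enum` is injective up to `≈`, equal elements receive the same index; equality is therefore
  -- decided on indices.
  _≟_ : ∀ x y → Dec (x ≈ y)
  x ≟ y = map′
    (λ eq → trans (sym (enum-index x)) (trans (reflexive (≡.cong enum eq)) (enum-index y)))
    (λ eq → enum-injective _ _ (trans (enum-index x) (trans eq (sym (enum-index y)))))
    (index x Fin.≟ index y)

  -- Made total by the default value 0 at 0, so that no proof of nonvanishing has to be carried in
  -- terms.
  _⁻¹ : Carrier → Carrier
  x ⁻¹ with x ≟ 0#
  ... | yes _  = 0#
  ... | no x≉0 = proj₁ (inv x x≉0)

  ⁻¹-inverseʳ : ∀ {x} → x ≉ 0# → x * x ⁻¹ ≈ 1#
  ⁻¹-inverseʳ {x} x≉0 with x ≟ 0#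
  ... | yes x≈0 = contradiction x≈0 x≉0
  ... | no x≉0  = proj₂ (inv x x≉0)

  *-cancelˡ : ∀ {x y z} → x ≉ 0# → x * y ≈ x * z → y ≈ z
  *-cancelˡ {x} {y} {z} x≉0 eq = begin
    y              ≈⟨ insert y ⟩
    x ⁻¹ * (x * y) ≈⟨ *-congˡ eq ⟩
    x ⁻¹ * (x * z) ≈⟨ insert z ⟨
    z              ∎
    where
    insert : ∀ u → u ≈ x ⁻¹ * (x * u)
    insert u = begin
      u               ≈⟨ *-identityˡ u ⟨
      1# * u          ≈⟨ *-congʳ (⁻¹-inverseʳ x≉0) ⟨
      (x * x ⁻¹) * u  ≈⟨ solve 3 (λ x i u → (x :* i) :* u := i :* (x :* u)) refl x (x ⁻¹) u ⟩
      x ⁻¹ * (x * u)  ∎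

  *-≉0 : ∀ {x y} → x ≉ 0# → y ≉ 0# → x * y ≉ 0#
  *-≉0 x≉0 y≉0 xy≈0 = y≉0 (*-cancelˡ x≉0 (trans xy≈0 (sym (zeroʳ _))))

  ≉0-*ˡ : ∀ {x y} → x * y ≉ 0# → x ≉ 0#
  ≉0-*ˡ xy≉0 x≈0 = xy≉0 (trans (*-congʳ x≈0) (zeroˡ _))

  ≉0-*ʳ : ∀ {x y} → x * y ≉ 0# → y ≉ 0#
  ≉0-*ʳ xy≉0 y≈0 = xy≉0 (trans (*-congˡ y≈0) (zeroʳ _))

  ^-≉0 : ∀ {x} k → x ≉ 0# → x ^ k ≉ 0#
  ^-≉0 zero    x≉0 = 0≉1 ∘ sym
  ^-≉0 (suc k) x≉0 = *-≉0 x≉0 (^-≉0 k x≉0)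

  ⁻¹-≉0 : ∀ {x} → x ≉ 0# → x ⁻¹ ≉ 0#
  ⁻¹-≉0 x≉0 = ≉0-*ʳ (λ eq → 0≉1 (trans (sym eq) (⁻¹-inverseʳ x≉0)))

  ≉-difference : ∀ {x y} → x ≉ y → x - y ≉ 0#
  ≉-difference x≉y = x≉y ∘ x∙y⁻¹≈ε⇒x≈y _ _

  -- Polynomial functions and their roots.

  -- Degree n l f says that f is a polynomial function of formal degree at most n, in which
  -- the coefficient of xⁿ is l; l may be zero.
  data Degree : ℕ → Carrier → (Carrier → Carrier) → Set where
    constant : ∀ {f l} → (∀ x → f x ≈ l) → Degree 0 l f
    horner   : ∀ {f g l c d} → Degree d l g → (∀ x → f x ≈ x * g x + c) → Degree (suc d) l f

  degree-cong : ∀ {d l m f g} → l ≈ m → (∀ x → f x ≈ g x) → Degree d l f → Degree d m g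
  degree-cong l≈m f≗g (constant eq) = constant λ x → trans (sym (f≗g x)) (trans (eq x) l≈m)
  degree-cong l≈m f≗g (horner D eq) =
    horner (degree-cong l≈m (λ _ → refl) D) λ x → trans (sym (f≗g x)) (eq x)

  degree-+ : ∀ {d l m f g} → Degree d l f → Degree d m g → Degree d (l + m) (λ x → f x + g x)
  degree-+ (constant eq) (constant eq′) = constant λ x → +-cong (eq x) (eq′ x)
  degree-+ (horner D eq) (horner E eq′) = horner (degree-+ D E) λ x →
    trans (+-cong (eq x) (eq′ x))
      (solve 5 (λ x u v c d → (x :* u :+ c) :+ (x :* v :+ d) := x :* (u :+ v) :+ (c :+ d))
        refl x _ _ _ _)

  degree-scale : ∀ {d l f} c → Degree d l f → Degree d (c * l) (λ x → c * f x)
  degree-scale c (constant eq) = constant λ x → *-congˡ (eq x)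
  degree-scale c (horner D eq) = horner (degree-scale c D) λ x →
    trans (*-congˡ (eq x))
      (solve 4 (λ x u c d → c :* (x :* u :+ d) := x :* (c :* u) :+ c :* d) refl x _ c _)

  degree-raise : ∀ {d l f} → Degree d l f → Degree (suc d) 0# f
  degree-raise (constant eq) = horner (constant λ _ → refl) λ x →
    trans (eq x) (sym (trans (+-congʳ (zeroʳ x)) (+-identityˡ _)))
  degree-raise (horner D eq) = horner (degree-raise D) eq

  degree-shift : ∀ {d l f} → Degree d l f → Degree (suc d) l (λ x → x * f x)
  degree-shift D = horner D λ x → sym (+-identityʳ _)

  degree-raise-+ : ∀ m {d l f} → Degree d l f → Degree (suc m ℕ.+ d) 0# f
  degree-raise-+ zero    D = degree-raise D
  degree-raise-+ (suc m) D = degree-raise (degree-raise-+ m D)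

  -- Horner's form gives `(x * g + c) * h = x * (g * h) + c * h`. The second summand is padded with
  -- a zero top coefficient, so the leading coefficient comes from the first alone.
  degree-* : ∀ {d e l m f g} → Degree d l f → Degree e m g → Degree (d ℕ.+ e) (l * m) (λ x → f x * g x)
  degree-* (constant eq) E = degree-cong refl (λ x → *-congʳ (sym (eq x))) (degree-scale _ E)
  degree-* {suc d} (horner {c = c} D eq) E =
    degree-cong (+-identityʳ _)
      (λ x → trans (solve 4 (λ x u v c → x :* (u :* v) :+ c :* v := (x :* u :+ c) :* v) refl x _ _ c)
                   (*-congʳ (sym (eq x))))
      (degree-+ (degree-shift (degree-* D E)) (degree-raise-+ d (degree-scale c E)))

  degree-^ : ∀ m → Degree m 1# (_^ m)
  degree-^ zero    = constant λ _ → refl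
  degree-^ (suc m) = degree-shift (degree-^ m)

  degree-id : Degree 1 1# (λ x → x)
  degree-id = degree-cong refl *-identityʳ (degree-^ 1)

  degree-< : ∀ {d e l f} → d ℕ.< e → Degree d l f → Degree e 0# f
  degree-< {d} {f = f} (s≤s {n = e′} d≤e) D =
    ≡.subst (λ k → Degree k 0# f) (≡.cong suc (ℕₚ.m∸n+n≡m d≤e)) (degree-raise-+ (e′ ℕ.∸ d) D)

  degree-minus : ∀ {d l f} r → Degree (suc d) l f → Degree (suc d) l (λ x → f x - r)
  degree-minus r D = degree-cong (+-identityʳ _) (λ _ → refl)
    (degree-+ D (degree-< (s≤s z≤n) (constant λ _ → refl)))

  -- Synthetic division by `x - r`. The quotient keeps the leading coefficient, which lets the root
  -- count below proceed by induction.
  degree-factor : ∀ {d l f} r → Degree (suc d) l f →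
    ∃ λ g → Degree d l g × (∀ x → f x ≈ (x - r) * g x + f r)
  degree-factor {zero} {l} r (horner {c = c} (constant eq′) eq) =
    (λ _ → l) , constant (λ _ → refl) , λ x → begin
      _                             ≈⟨ eval x ⟩
      x * l + c                     ≈⟨ solve 4 (λ x l r c →
          x :* l :+ c := (x :- r) :* l :+ (r :* l :+ c)) refl x l r c ⟩
      (x - r) * l + (r * l + c)     ≈⟨ +-congˡ (eval r) ⟨
      _                             ∎
    where
    eval : ∀ x → _ ≈ x * l + c
    eval x = trans (eq x) (+-congʳ (*-congˡ (eq′ x)))
  degree-factor {suc d} r (horner {g = g} {c = c} D eq) with degree-factor r D
  ... | h , E , eq′ =
    (λ x → x * h x + g r) , horner E (λ _ → refl) , λ x → begin
      _                                          ≈⟨ eq x ⟩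
      x * g x + c                                ≈⟨ +-congʳ (*-congˡ (eq′ x)) ⟩
      x * ((x - r) * h x + g r) + c              ≈⟨ solve 5 (λ x r h g c →
          x :* ((x :- r) :* h :+ g) :+ c := (x :- r) :* (x :* h :+ g) :+ (r :* g :+ c))
          refl x r (h x) (g r) c ⟩
      (x - r) * (x * h x + g r) + (r * g r + c)  ≈⟨ +-congˡ (eq r) ⟨
      _                                          ∎

  -- If the first point is a root, it is divided out. A non-root of the quotient among the remaining
  -- points is a non-root of `f`, because distinctness keeps the linear factor nonzero.
  nonroot-among : ∀ {d l f} → Degree d l f → l ≉ 0# → (v : Fin (suc d) → Carrier) →
    (∀ i j → v i ≈ v j → i ≡ j) → ∃ λ i → f (v i) ≉ 0#
  nonroot-among (constant eq) l≉0 v v-injective = zero , λ f≈0 → l≉0 (trans (sym (eq _)) f≈0)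
  nonroot-among {suc d} {f = f} D@(horner _ _) l≉0 v v-injective with f (v zero) ≟ 0#
  ... | no f≉0  = zero , f≉0
  ... | yes f≈0 with degree-factor (v zero) D
  ... | g , E , factor
    with nonroot-among E l≉0 (v ∘ suc) (λ i j → Finₚ.suc-injective ∘ v-injective (suc i) (suc j))
  ... | i , g≉0 = suc i , λ f≈0′ →
    *-≉0 (≉-difference (λ eq → contradiction (v-injective (suc i) zero eq) λ ())) g≉0 (begin
      (v (suc i) - v zero) * g (v (suc i))               ≈⟨ +-identityʳ _ ⟨
      (v (suc i) - v zero) * g (v (suc i)) + 0#          ≈⟨ +-congˡ f≈0 ⟨
      (v (suc i) - v zero) * g (v (suc i)) + f (v zero)  ≈⟨ factor _ ⟨
      f (v (suc i))                                      ≈⟨ f≈0′ ⟩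
      0#                                                 ∎)

  nonroot : ∀ {d l f} → Degree d l f → l ≉ 0# → d ℕ.< n → ∃ λ x → f x ≉ 0#
  nonroot D l≉0 d<n
    with nonroot-among D l≉0 (λ i → enum (Fin.inject≤ i d<n))
           (λ i j → Finₚ.inject≤-injective d<n d<n i j ∘ enum-injective _ _)
  ... | i , fx≉0 = _ , fx≉0

  differenceProduct : ∀ {r} → (Carrier → Carrier) → (Fin r → Carrier) → Carrier → Carrier
  differenceProduct {zero}  f v x = 1#
  differenceProduct {suc r} f v x = (f x - v zero) * differenceProduct f (v ∘ suc) x

  degree-differenceProduct : ∀ {r d f} → Degree (suc d) 1# f → (v : Fin r → Carrier) →
    Degree (r ℕ.* suc d) 1# (differenceProduct f v)
  degree-differenceProduct {zero}  D v = constant λ _ → refl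
  degree-differenceProduct {suc r} D v = degree-cong (*-identityˡ 1#) (λ _ → refl)
    (degree-* (degree-minus (v zero) D) (degree-differenceProduct D (v ∘ suc)))

  differenceProduct-≉0 : ∀ {r f} (v : Fin r → Carrier) {x} → differenceProduct f v x ≉ 0# →
    ∀ i → f x ≉ v i
  differenceProduct-≉0 v P≉0 zero    eq = ≉0-*ˡ P≉0 (x≈y⇒x∙y⁻¹≈ε eq)
  differenceProduct-≉0 v P≉0 (suc i) eq = differenceProduct-≉0 (v ∘ suc) (≉0-*ʳ P≉0) i eq

  -- The product of the `r` differences `f x - v i` is monic of degree `r * suc d`, which is less
  -- than the size of the field, so it does not vanish everywhere.
  avoid : ∀ {r d f} → Degree (suc d) 1# f → (v : Fin r → Carrier) → r ℕ.* suc d ℕ.< n →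
    ∃ λ x → ∀ i → f x ≉ v i
  avoid D v r*d<n with nonroot (degree-differenceProduct D v) (0≉1 ∘ sym) r*d<n
  ... | x , P≉0 = x , differenceProduct-≉0 v P≉0

  -- Greedy choice: while fewer than `m` elements are chosen, `step` supplies one more that differs
  -- from all of them.
  select : ∀ {P : Carrier → Set} m →
    (∀ {r} → r ℕ.< m → (v : Fin r → Carrier) → ∃ λ x → P x × (∀ i → x ≉ v i)) →
    ∃ λ (v : Fin m → Carrier) → (∀ i → P (v i)) × (∀ i j → v i ≈ v j → i ≡ j)
  select zero    step = (λ ()) , (λ ()) , λ ()
  select {P} (suc m) step with select {P} m (step ∘ ℕₚ.m≤n⇒m≤1+n)
  ... | v , Pv , v-injective with step ℕₚ.≤-refl v
  ... | x , Px , x≉v = w , Pw , w-injective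
    where
    w : Fin (suc m) → Carrier
    w zero    = x
    w (suc i) = v i
    Pw : ∀ i → P (w i)
    Pw zero    = Px
    Pw (suc i) = Pv i
    w-injective : ∀ i j → w i ≈ w j → i ≡ j
    w-injective zero    zero    eq = ≡.refl
    w-injective zero    (suc j) eq = contradiction eq (x≉v j)
    w-injective (suc i) zero    eq = contradiction (sym eq) (x≉v i)
    w-injective (suc i) (suc j) eq = ≡.cong suc (v-injective i j eq)

  -- Sums and products over the whole field.

  module Reindex (_∙_ : Carrier → Carrier → Carrier) (ε : Carrier)
                 (isCommutativeMonoid : IsCommutativeMonoid _≈_ _∙_ ε) where
    commutativeMonoid : CommutativeMonoid 0ℓ 0ℓ
    commutativeMonoid = record { isCommutativeMonoid = isCommutativeMonoid }

    open Sum commutativeMonoid public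
      using (sum; sum-permute; sum-cong-≋; sum-replicate; ∑-distrib-+)

    -- A bijection of the field induces a permutation of the indices. The monoid is a parameter so
    -- that the argument serves both the sum and the product of all elements.
    sum-reindex : ∀ (f σ τ : Carrier → Carrier) →
      (∀ {x y} → x ≈ y → f x ≈ f y) →
      (∀ {x y} → x ≈ y → σ x ≈ σ y) → (∀ {x y} → x ≈ y → τ x ≈ τ y) →
      (∀ x → σ (τ x) ≈ x) → (∀ x → τ (σ x) ≈ x) →
      sum (f ∘ enum) ≈ sum (f ∘ σ ∘ enum)
    sum-reindex f σ τ f-cong σ-cong τ-cong στ τσ = trans
      (sum-permute (f ∘ enum) π)
      (sum-cong-≋ λ i → f-cong (enum-index (σ (enum i))))
      where
      inverse : ∀ (σ τ : Carrier → Carrier) → (∀ {x y} → x ≈ y → σ x ≈ σ y) →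
        (∀ x → σ (τ x) ≈ x) → ∀ i → index (σ (enum (index (τ (enum i))))) ≡ i
      inverse σ τ σ-cong στ i =
        enum-injective _ _ (trans (enum-index _) (trans (σ-cong (enum-index _)) (στ _)))
      π : Permutation n n
      π = permutation (λ i → index (σ (enum i))) (λ i → index (τ (enum i)))
        (inverse σ τ σ-cong στ) (inverse τ σ τ-cong τσ)

  module Additive = Reindex _+_ 0# +-isCommutativeMonoid
  module Multiplicative = Reindex _*_ 1# *-isCommutativeMonoid

  -- Translation by 1 permutes the field, so adding 1 to each of the `n` elements leaves their sum
  -- unchanged.
  n·1≈0 : n · 1# ≈ 0#
  n·1≈0 = begin
    n · 1#                    ≈⟨ solve 2 (λ a b → b := (b :+ a) :- a) refl total (n · 1#) ⟩
    (n · 1# + total) - total  ≈⟨ +-congʳ shifted ⟩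
    total - total             ≈⟨ -‿inverseʳ total ⟩
    0#                        ∎
    where
    open Additive
    total = sum enum
    shifted : n · 1# + total ≈ total
    shifted = begin
      n · 1# + total             ≈⟨ +-congʳ (sum-replicate n) ⟨
      sum (λ (_ : Fin n) → 1#) + total  ≈⟨ ∑-distrib-+ (λ _ → 1#) enum ⟨
      sum (λ i → 1# + enum i)    ≈⟨ sum-reindex (λ x → x) (λ x → 1# + x) (_- 1#) (λ eq → eq) +-congˡ +-congʳ
                                      (λ x → solve 1 (λ x → con 1ℤ :+ (x :- con 1ℤ) := x) refl x)
                                      (λ x → solve 1 (λ x → (con 1ℤ :+ x) :- con 1ℤ := x) refl x) ⟨
      total                      ∎

  product-single : ∀ {m} (t : Fin m → Carrier) x i → t i ≈ x → (∀ j → j ≢ i → t j ≈ 1#) →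
    Multiplicative.sum t ≈ x
  product-single {suc m} t x zero ti≈x t≈1 = begin
    t zero * sum (t ∘ suc)         ≈⟨ *-cong ti≈x (sum-cong-≋ (λ j → t≈1 (suc j) λ ())) ⟩
    x * sum (λ (_ : Fin m) → 1#)   ≈⟨ *-congˡ (ones m) ⟩
    x * 1#                         ≈⟨ *-identityʳ x ⟩
    x                              ∎
    where
    open Multiplicative
    ones : ∀ m → sum (λ (_ : Fin m) → 1#) ≈ 1#
    ones zero    = refl
    ones (suc m) = trans (*-identityˡ _) (ones m)
  product-single {suc m} t x (suc i) ti≈x t≈1 = trans
    (*-cong (t≈1 zero λ ())
      (product-single (t ∘ suc) x i ti≈x λ j j≢i → t≈1 (suc j) (j≢i ∘ Finₚ.suc-injective)))
    (*-identityˡ x)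

  product-≉0 : ∀ {m} (t : Fin m → Carrier) → (∀ i → t i ≉ 0#) → Multiplicative.sum t ≉ 0#
  product-≉0 {zero}  t t≉0 = 0≉1 ∘ sym
  product-≉0 {suc m} t t≉0 = *-≉0 (t≉0 zero) (product-≉0 (t ∘ suc) (t≉0 ∘ suc))

  -- With u replacing 0 by 1, the product U of u over the field satisfies U · x = xⁿ · U:
  -- multiplication by x ≠ 0 permutes the field and u (x * y) * h y = x * u y.
  xⁿ≈x : ∀ x → x ^ n ≈ x
  xⁿ≈x x with x ≟ 0#
  ... | yes x≈0 = trans (^-congˡ n x≈0) (trans (0^ (index 0#)) (sym x≈0))
    where
    0^ : ∀ {m} → Fin m → 0# ^ m ≈ 0#
    0^ {suc m} _ = zeroˡ _
  ... | no x≉0 = *-cancelˡ (product-≉0 (u ∘ enum) (u≉0 ∘ enum)) (begin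
      U * x ^ n                                  ≈⟨ *-comm _ _ ⟩
      x ^ n * U                                  ≈⟨ *-congʳ (sum-replicate n) ⟨
      sum (λ (_ : Fin n) → x) * U                ≈⟨ ∑-distrib-+ (λ _ → x) (u ∘ enum) ⟨
      sum (λ i → x * u (enum i))                 ≈⟨ sum-cong-≋ (λ i → u-h (enum i)) ⟨
      sum (λ i → u (x * enum i) * h (enum i))    ≈⟨ ∑-distrib-+ (λ i → u (x * enum i)) (h ∘ enum) ⟩
      sum (u ∘ (x *_) ∘ enum) * sum (h ∘ enum)   ≈⟨ *-cong
          (sym (sum-reindex u (x *_) (x ⁻¹ *_) u-cong *-congˡ *-congˡ
            (inverse-acts (⁻¹-inverseʳ x≉0))
            (inverse-acts (trans (*-comm _ _) (⁻¹-inverseʳ x≉0)))))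
          (product-single (h ∘ enum) x (index 0#) (h-0 (enum-index 0#))
            λ j j≢ → h-≉0 λ eq → j≢ (enum-injective _ _ (trans eq (sym (enum-index 0#))))) ⟩
      U * x                                      ∎)
    where
    open Multiplicative
    u h : Carrier → Carrier
    u y with y ≟ 0#
    ... | yes _ = 1#
    ... | no  _ = y
    -- `h` corrects the single place `y = 0`, where `u (x * y)` is 1 while `x * u y` is `x`.
    h y with y ≟ 0#
    ... | yes _ = x
    ... | no  _ = 1#
    U = sum (u ∘ enum)
    inverse-acts : ∀ {v w} → v * w ≈ 1# → ∀ y → v * (w * y) ≈ y
    inverse-acts vw≈1 y = trans (sym (*-assoc _ _ _)) (trans (*-congʳ vw≈1) (*-identityˡ y))
    u≉0 : ∀ y → u y ≉ 0#
    u≉0 y with y ≟ 0#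
    ... | yes _   = 0≉1 ∘ sym
    ... | no y≉0  = y≉0
    u-cong : ∀ {y z} → y ≈ z → u y ≈ u z
    u-cong {y} {z} y≈z with y ≟ 0# | z ≟ 0#
    ... | yes _   | yes _   = refl
    ... | no _    | no _    = y≈z
    ... | yes y≈0 | no z≉0  = contradiction (trans (sym y≈z) y≈0) z≉0
    ... | no y≉0  | yes z≈0 = contradiction (trans y≈z z≈0) y≉0
    h-0 : ∀ {y} → y ≈ 0# → h y ≈ x
    h-0 {y} y≈0 with y ≟ 0#
    ... | yes _  = refl
    ... | no y≉0 = contradiction y≈0 y≉0
    h-≉0 : ∀ {y} → y ≉ 0# → h y ≈ 1#
    h-≉0 {y} y≉0 with y ≟ 0#
    ... | yes y≈0 = contradiction y≈0 y≉0
    ... | no _    = refl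
    u-h : ∀ y → u (x * y) * h y ≈ x * u y
    u-h y with y ≟ 0# | (x * y) ≟ 0#
    ... | yes y≈0 | yes _     = *-comm _ _
    ... | no y≉0  | no _      = *-identityʳ _
    ... | yes y≈0 | no xy≉0   = contradiction (trans (*-congˡ y≈0) (zeroʳ x)) xy≉0
    ... | no y≉0  | yes xy≈0  = contradiction xy≈0 (*-≉0 x≉0 y≉0)

-- Automorphisms of order dividing three and their norm.

-- Isolates the properties of the map raising to the power `q` on which the construction rests, so
-- that norms become products of three conjugates instead of high powers.
record CubicAutomorphism {n} (F : FiniteField n) : Set where
  open FiniteField F
  field
    s       : Carrier → Carrier
    s-cong  : ∀ {x y} → x ≈ y → s x ≈ s y
    s-+     : ∀ x y → s (x + y) ≈ s x + s y
    s-*     : ∀ x y → s (x * y) ≈ s x * s y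
    s-1     : s 1# ≈ 1#
    s³≈id   : ∀ x → s (s (s x)) ≈ x

module Norm {n} {F : FiniteField n} (σ : CubicAutomorphism F) where
  open FiniteField F hiding (zero)
  open CubicAutomorphism σ public
  open IntegerSolver cring
  open FieldProperties F
  open import Algebra.Properties.Ring ring using (+-inverseʳ-unique; x+x≈x⇒x≈0)
  open import Algebra.Properties.Semiring.Mult.TCOptimised semiring using () renaming (_×_ to _·_)
  open import Algebra.Properties.Semiring.Exp semiring using (_^_)
  open import Relation.Binary.Reasoning.Setoid setoid

  s-0 : s 0# ≈ 0#
  s-0 = x+x≈x⇒x≈0 _ (trans (sym (s-+ 0# 0#)) (s-cong (+-identityˡ 0#)))

  s-neg : ∀ x → s (- x) ≈ - s x
  s-neg x = +-inverseʳ-unique _ _ (trans (sym (s-+ x (- x))) (trans (s-cong (-‿inverseʳ x)) s-0))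

  norm : Carrier → Carrier
  norm x = x * s x * s (s x)

  norm-cong : ∀ {x y} → x ≈ y → norm x ≈ norm y
  norm-cong eq = *-cong (*-cong eq (s-cong eq)) (s-cong (s-cong eq))

  norm-* : ∀ x y → norm (x * y) ≈ norm x * norm y
  norm-* x y = trans
    (*-cong (*-congˡ (s-* x y)) (trans (s-cong (s-* x y)) (s-* _ _)))
    (solve 6 (λ a b c d e f → ((a :* b) :* (c :* d)) :* (e :* f) := ((a :* c) :* e) :* ((b :* d) :* f))
      refl x y _ _ _ _)

  s-norm : ∀ x → s (norm x) ≈ norm x
  s-norm x = begin
    s (x * s x * s (s x))      ≈⟨ trans (s-* _ _) (*-cong (s-* _ _) (s³≈id x)) ⟩
    s x * s (s x) * x          ≈⟨ solve 3 (λ a b c → b :* c :* a := a :* b :* c) refl x _ _ ⟩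
    norm x                     ∎

  s-≉0 : ∀ {x} → x ≉ 0# → s x ≉ 0#
  s-≉0 x≉0 sx≈0 = x≉0 (trans (sym (s³≈id _)) (trans (s-cong (trans (s-cong sx≈0) s-0)) s-0))

  norm-≉0 : ∀ {x} → x ≉ 0# → norm x ≉ 0#
  norm-≉0 x≉0 = *-≉0 (*-≉0 x≉0 (s-≉0 x≉0)) (s-≉0 (s-≉0 x≉0))

  s-fromℕ : ∀ m → s (m · 1#) ≈ m · 1#
  s-fromℕ zero          = s-0
  s-fromℕ (suc zero)    = s-1
  s-fromℕ (suc (suc m)) = trans (s-+ _ _) (+-cong (s-fromℕ (suc m)) s-1)

  s-^ : ∀ x m → s (x ^ m) ≈ s x ^ m
  s-^ x zero    = s-1
  s-^ x (suc m) = trans (s-* _ _) (*-congˡ (s-^ x m))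

  s-difference : ∀ x y → s (x - y) ≈ s x - s y
  s-difference x y = trans (s-+ x (- y)) (+-congˡ (s-neg y))

-- Six points and three centres: the copy of K_{3,6}.

module SixPoints {n} {F : FiniteField n} (σ : CubicAutomorphism F) where
  open FiniteField F hiding (zero)
  open IntegerSolver cring
  open FieldProperties F
  open Norm σ
  open import Relation.Binary.Reasoning.Setoid setoid
  open import Algebra.Properties.Ring ring using (-0#≈0#; -‿involutive)
  open import Algebra.Properties.Semiring.Exp semiring using (^-congˡ)

  -- The quantities are syntax trees in `x`, `y`, `k`: the solver can normalise them, and the action
  -- of `s` can be defined on them by recursion.
  Xᵖ Yᵖ Zᵖ Kᵖ : Polynomial 3
  Xᵖ = var 0F
  Yᵖ = var 1F
  Zᵖ = :- (Xᵖ :+ Yᵖ)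
  Kᵖ = var 2F

  Qᵖ : Polynomial 3
  Qᵖ = Xᵖ :* Xᵖ :+ Xᵖ :* Yᵖ :+ Yᵖ :* Yᵖ

  -- The formal counterpart of `s`, cycling `x`, `y`, `z` and fixing `k`; that `Zᵖ` returns to `Xᵖ`
  -- holds after normalisation.
  rotate : Polynomial 3 → Polynomial 3
  rotate (op o p q)    = op o (rotate p) (rotate q)
  rotate (con c)       = con c
  rotate (var 0F)      = Yᵖ
  rotate (var 1F)      = Zᵖ
  rotate (var 2F)      = Kᵖ
  rotate (p :^ m)      = rotate p :^ m
  rotate (:- p)        = :- rotate p

  normᵖ : Polynomial 3 → Polynomial 3
  normᵖ p = p :* rotate p :* rotate (rotate p)

  -- The j-th point is num j / den j.
  num den : Fin 6 → Polynomial 3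
  num 0F = Yᵖ
  num 1F = Yᵖ :+ Kᵖ
  num 2F = Yᵖ :- Kᵖ
  num 3F = Zᵖ :* Xᵖ
  num 4F = Xᵖ :* (Zᵖ :- Yᵖ)
  num 5F = Zᵖ :* (Yᵖ :- Xᵖ)
  den 0F = con 1ℤ
  den 1F = con 1ℤ
  den 2F = con 1ℤ
  den 3F = Yᵖ
  den 4F = Yᵖ :- Xᵖ
  den 5F = Zᵖ :- Yᵖ

  centreᵖ weightᵖ : Fin 3 → Polynomial 3
  centreᵖ 0F = con 0ℤ
  centreᵖ 1F = Xᵖ
  centreᵖ 2F = Zᵖ
  weightᵖ 0F = Xᵖ :* Yᵖ :* Zᵖ
  weightᵖ 1F = :- (Xᵖ :* Yᵖ :* Zᵖ)
  weightᵖ 2F = :- (Xᵖ :* Yᵖ :* Zᵖ)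

  -- A multiple of k² - (x² + xy + y²), which vanishes for the x, y, k used below.
  defect : Fin 6 → Polynomial 3
  defect 1F = Kᵖ :* (Kᵖ :* Kᵖ :- Qᵖ)
  defect 2F = :- Kᵖ :* (Kᵖ :* Kᵖ :- Qᵖ)
  defect _  = con 0ℤ

  -- The two sides of the norm equation for `num j / den j + centre`, after multiplication by the
  -- norm of the denominator.
  shiftedˡ shiftedʳ : Fin 3 → Fin 6 → Polynomial 3
  shiftedˡ i j = normᵖ (num j :+ centreᵖ i :* den j)
  shiftedʳ i j = weightᵖ i :* normᵖ (den j) :+ defect j

  -- The numerator of the difference of the `i`-th and the `j`-th point.
  cross : (i j : Fin 6) → Polynomial 3
  cross i j = num i :* den j :- num j :* den i

  -- Each case is an identity over the integers, with `defect` absorbing the relation for `k²`. The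
  -- expressions unfold only at literal indices, hence the case split.
  normᵖ-shifted : ∀ i j ρ → ⟦ shiftedˡ i j ⟧ ρ ≈ ⟦ shiftedʳ i j ⟧ ρ
  normᵖ-shifted 0F 0F ρ = prove ρ (shiftedˡ 0F 0F) (shiftedʳ 0F 0F) refl
  normᵖ-shifted 0F 1F ρ = prove ρ (shiftedˡ 0F 1F) (shiftedʳ 0F 1F) refl
  normᵖ-shifted 0F 2F ρ = prove ρ (shiftedˡ 0F 2F) (shiftedʳ 0F 2F) refl
  normᵖ-shifted 0F 3F ρ = prove ρ (shiftedˡ 0F 3F) (shiftedʳ 0F 3F) refl
  normᵖ-shifted 0F 4F ρ = prove ρ (shiftedˡ 0F 4F) (shiftedʳ 0F 4F) refl
  normᵖ-shifted 0F 5F ρ = prove ρ (shiftedˡ 0F 5F) (shiftedʳ 0F 5F) refl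
  normᵖ-shifted 1F 0F ρ = prove ρ (shiftedˡ 1F 0F) (shiftedʳ 1F 0F) refl
  normᵖ-shifted 1F 1F ρ = prove ρ (shiftedˡ 1F 1F) (shiftedʳ 1F 1F) refl
  normᵖ-shifted 1F 2F ρ = prove ρ (shiftedˡ 1F 2F) (shiftedʳ 1F 2F) refl
  normᵖ-shifted 1F 3F ρ = prove ρ (shiftedˡ 1F 3F) (shiftedʳ 1F 3F) refl
  normᵖ-shifted 1F 4F ρ = prove ρ (shiftedˡ 1F 4F) (shiftedʳ 1F 4F) refl
  normᵖ-shifted 1F 5F ρ = prove ρ (shiftedˡ 1F 5F) (shiftedʳ 1F 5F) refl
  normᵖ-shifted 2F 0F ρ = prove ρ (shiftedˡ 2F 0F) (shiftedʳ 2F 0F) refl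
  normᵖ-shifted 2F 1F ρ = prove ρ (shiftedˡ 2F 1F) (shiftedʳ 2F 1F) refl
  normᵖ-shifted 2F 2F ρ = prove ρ (shiftedˡ 2F 2F) (shiftedʳ 2F 2F) refl
  normᵖ-shifted 2F 3F ρ = prove ρ (shiftedˡ 2F 3F) (shiftedʳ 2F 3F) refl
  normᵖ-shifted 2F 4F ρ = prove ρ (shiftedˡ 2F 4F) (shiftedʳ 2F 4F) refl
  normᵖ-shifted 2F 5F ρ = prove ρ (shiftedˡ 2F 5F) (shiftedʳ 2F 5F) refl

  module Points (x y k : Carrier)
    (sx≈y : s x ≈ y) (sy≈z : s y ≈ - (x + y)) (sk≈k : s k ≈ k)
    (k²≈quad : k * k ≈ x * x + x * y + y * y)
    (k≉0 : k ≉ 0#) (2≉0 : 1# + 1# ≉ 0#) (3≉0 : 1# + 1# + 1# ≉ 0#) where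

    z Q : Carrier
    z = - (x + y)
    Q = x * x + x * y + y * y

    sz≈x : s z ≈ x
    sz≈x = begin
      s (- (x + y))     ≈⟨ trans (s-neg _) (-‿cong (trans (s-+ x y) (+-cong sx≈y sy≈z))) ⟩
      - (y + - (x + y)) ≈⟨ solve 2 (λ x y → :- (y :+ :- (x :+ y)) := x) refl x y ⟩
      x                 ∎

    Q≉0 : Q ≉ 0#
    Q≉0 Q≈0 = *-≉0 k≉0 k≉0 (trans k²≈quad Q≈0)

    x≉0 : x ≉ 0#
    x≉0 x≈0 = Q≉0 (begin
      x * x + x * y + y * y      ≈⟨ +-cong (+-cong (*-cong x≈0 x≈0) (*-congʳ x≈0)) (*-cong y≈0 y≈0) ⟩
      0# * 0# + 0# * y + 0# * 0# ≈⟨ solve 1 (λ y →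
          con 0ℤ :* con 0ℤ :+ con 0ℤ :* y :+ con 0ℤ :* con 0ℤ := con 0ℤ) refl y ⟩
      0#                         ∎)
      where
      y≈0 : y ≈ 0#
      y≈0 = trans (sym sx≈y) (trans (s-cong x≈0) s-0)

    y≉0 : y ≉ 0#
    y≉0 y≈0 = s-≉0 x≉0 (trans sx≈y y≈0)

    z≉0 : z ≉ 0#
    z≉0 z≈0 = s-≉0 y≉0 (trans sy≈z z≈0)

    -- Applying `s` to `y = z` gives `z = x`, so all three agree; as they sum to zero, `3y = 0`.
    y≉z : y ≉ z
    y≉z y≈z = *-≉0 3≉0 y≉0 (begin
      (1# + 1# + 1#) * y
        ≈⟨ solve 2 (λ x y → (con 1ℤ :+ con 1ℤ :+ con 1ℤ) :* y :=
             (y :- :- (x :+ y)) :+ (y :- :- (x :+ y)) :+ (:- (x :+ y) :- x)) refl x y ⟩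
      (y - z) + (y - z) + (z - x)
        ≈⟨ +-cong (+-cong (difference y≈z) (difference y≈z)) (difference z≈x) ⟩
      0# + 0# + 0#
        ≈⟨ trans (+-identityʳ _) (+-identityʳ _) ⟩
      0# ∎)
      where
      difference : ∀ {u v} → u ≈ v → u - v ≈ 0#
      difference u≈v = trans (+-congʳ u≈v) (-‿inverseʳ _)
      z≈x : z ≈ x
      z≈x = trans (sym sy≈z) (trans (s-cong y≈z) sz≈x)

    x≉y : x ≉ y
    x≉y x≈y = y≉z (trans (sym sx≈y) (trans (s-cong x≈y) sy≈z))

    z≉x : z ≉ x
    z≉x z≈x = x≉y (trans (sym sz≈x) (trans (s-cong z≈x) sx≈y))

    s-y-x : s (y - x) ≈ z - y
    s-y-x = trans (s-difference y x) (+-cong sy≈z (-‿cong sx≈y))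

    s-z-y : s (z - y) ≈ x - z
    s-z-y = trans (s-difference z y) (+-cong sz≈x (-‿cong sy≈z))

    -- As `x + y + z = 0`, subtracting the image `z - y` from `y - x` leaves `3y`.
    y-x-moved : s (y - x) ≉ y - x
    y-x-moved fixed = *-≉0 3≉0 y≉0 (begin
      (1# + 1# + 1#) * y       ≈⟨ solve 2 (λ x y → (con 1ℤ :+ con 1ℤ :+ con 1ℤ) :* y :=
                                   (y :- x) :- (:- (x :+ y) :- y)) refl x y ⟩
      (y - x) - (z - y)        ≈⟨ +-congˡ (-‿cong (trans (sym s-y-x) fixed)) ⟩
      (y - x) - (y - x)        ≈⟨ -‿inverseʳ _ ⟩
      0#                       ∎)

    z-y-moved : s (z - y) ≉ z - y
    z-y-moved fixed = *-≉0 3≉0 z≉0 (begin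
      (1# + 1# + 1#) * z       ≈⟨ solve 2 (λ x y → (con 1ℤ :+ con 1ℤ :+ con 1ℤ) :* :- (x :+ y) :=
                                   (:- (x :+ y) :- y) :- (x :- :- (x :+ y))) refl x y ⟩
      (z - y) - (x - z)        ≈⟨ +-congˡ (-‿cong (trans (sym s-z-y) fixed)) ⟩
      (z - y) - (z - y)        ≈⟨ -‿inverseʳ _ ⟩
      0#                       ∎)

    y-moved : s y ≉ y
    y-moved fixed = y≉z (trans (sym fixed) sy≈z)

    -‿≉0 : ∀ {u} → u ≉ 0# → - u ≉ 0#
    -‿≉0 u≉0 -u≈0 = u≉0 (trans (sym (-‿involutive _)) (trans (-‿cong -u≈0) -0#≈0#))

    -- Q ± k * t = k * (k ± t), and k ± t = 0 would put t in the fixed field of s.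
    Q-kt≉0 : ∀ {t} → s t ≉ t → Q - k * t ≉ 0#
    Q-kt≉0 {t} moved eq = *-≉0 k≉0 (≉-difference k≉t) (begin
      k * (k - t)      ≈⟨ solve 2 (λ k t → k :* (k :- t) := k :* k :- k :* t) refl k t ⟩
      k * k - k * t    ≈⟨ +-congʳ k²≈quad ⟩
      Q - k * t        ≈⟨ eq ⟩
      0#               ∎)
      where
      k≉t : k ≉ t
      k≉t k≈t = moved (trans (s-cong (sym k≈t)) (trans sk≈k k≈t))

    Q+kt≉0 : ∀ {t} → s t ≉ t → Q + k * t ≉ 0#
    Q+kt≉0 {t} moved eq = Q-kt≉0 { - t} moved′ (trans
      (solve 3 (λ q k t → q :- k :* :- t := q :+ k :* t) refl Q k t) eq)
      where
      moved′ : s (- t) ≉ - t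
      moved′ fixed = moved (begin
        s t           ≈⟨ s-cong (-‿involutive t) ⟨
        s (- - t)     ≈⟨ s-neg (- t) ⟩
        - s (- t)     ≈⟨ -‿cong fixed ⟩
        - - t         ≈⟨ -‿involutive t ⟩
        t             ∎)

    ρ : Vec Carrier 3
    ρ = x ∷ y ∷ k ∷ []

    nonzero-by : ∀ i j p → ⟦ cross i j ⟧↓ ρ ≈ ⟦ p ⟧↓ ρ → ⟦ p ⟧ ρ ≉ 0# → ⟦ cross i j ⟧ ρ ≉ 0#
    nonzero-by i j p eq p≉0 c≈0 = p≉0 (trans (sym (prove ρ (cross i j) p eq)) c≈0)

    -- Up to sign, each numerator is a product of factors among 2, `k`, `Q`, `x`, `z`, `z - x` and
    -- `Q ± k * t` with `t` moved by `s`.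
    cross-≉0 : ∀ i j → i Fin.< j → ⟦ cross i j ⟧ ρ ≉ 0#
    cross-≉0 0F 1F _ = nonzero-by 0F 1F (:- Kᵖ) refl (-‿≉0 k≉0)
    cross-≉0 0F 2F _ = nonzero-by 0F 2F Kᵖ refl k≉0
    cross-≉0 0F 3F _ = nonzero-by 0F 3F Qᵖ refl Q≉0
    cross-≉0 0F 4F _ = nonzero-by 0F 4F Qᵖ refl Q≉0
    cross-≉0 0F 5F _ = nonzero-by 0F 5F (:- Qᵖ) refl (-‿≉0 Q≉0)
    cross-≉0 1F 2F _ = nonzero-by 1F 2F ((con 1ℤ :+ con 1ℤ) :* Kᵖ) refl (*-≉0 2≉0 k≉0)
    cross-≉0 1F 3F _ = nonzero-by 1F 3F (Qᵖ :+ Kᵖ :* Yᵖ) refl (Q+kt≉0 y-moved)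
    cross-≉0 1F 4F _ = nonzero-by 1F 4F (Qᵖ :+ Kᵖ :* (Yᵖ :- Xᵖ)) refl (Q+kt≉0 y-x-moved)
    cross-≉0 1F 5F _ = nonzero-by 1F 5F (:- (Qᵖ :- Kᵖ :* (Zᵖ :- Yᵖ))) refl (-‿≉0 (Q-kt≉0 z-y-moved))
    cross-≉0 2F 3F _ = nonzero-by 2F 3F (Qᵖ :- Kᵖ :* Yᵖ) refl (Q-kt≉0 y-moved)
    cross-≉0 2F 4F _ = nonzero-by 2F 4F (Qᵖ :- Kᵖ :* (Yᵖ :- Xᵖ)) refl (Q-kt≉0 y-x-moved)
    cross-≉0 2F 5F _ = nonzero-by 2F 5F (:- (Qᵖ :+ Kᵖ :* (Zᵖ :- Yᵖ))) refl (-‿≉0 (Q+kt≉0 z-y-moved))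
    cross-≉0 3F 4F _ = nonzero-by 3F 4F (Xᵖ :* Qᵖ) refl (*-≉0 x≉0 Q≉0)
    cross-≉0 3F 5F _ = nonzero-by 3F 5F (:- (Zᵖ :* Qᵖ)) refl (-‿≉0 (*-≉0 z≉0 Q≉0))
    cross-≉0 4F 5F _ = nonzero-by 4F 5F (:- ((Zᵖ :- Xᵖ) :* Qᵖ)) refl
      (-‿≉0 (*-≉0 (≉-difference z≉x) Q≉0))
    cross-≉0 _ 0F ()
    cross-≉0 (suc _) 1F (s≤s ())
    cross-≉0 (suc (suc _)) 2F (s≤s (s≤s ()))
    cross-≉0 (suc (suc (suc _))) 3F (s≤s (s≤s (s≤s ())))
    cross-≉0 (suc (suc (suc (suc _)))) 4F (s≤s (s≤s (s≤s (s≤s ()))))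
    cross-≉0 5F 5F (s≤s (s≤s (s≤s (s≤s (s≤s ())))))

    value : Polynomial 3 → Carrier
    value p = ⟦ p ⟧ ρ

    -- A ring homomorphism fixing the integer constants is determined on expressions by its action
    -- on the three variables.
    s-value : ∀ p → s (value p) ≈ value (rotate p)
    s-value (op [+] p q)       = trans (s-+ _ _) (+-cong (s-value p) (s-value q))
    s-value (op [*] p q)       = trans (s-* _ _) (*-cong (s-value p) (s-value q))
    s-value (con (+ m))        = s-fromℕ m
    s-value (con (-[1+ m ]))   = trans (s-neg _) (-‿cong (s-fromℕ (suc m)))
    s-value (var 0F)           = sx≈y
    s-value (var 1F)           = sy≈z
    s-value (var 2F)           = sk≈k
    s-value (p :^ m)           = trans (s-^ _ m) (^-congˡ m (s-value p))
    s-value (:- p)             = trans (s-neg _) (-‿cong (s-value p))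

    norm-value : ∀ p → norm (value p) ≈ value (normᵖ p)
    norm-value p = *-cong (*-congˡ (s-value p)) (trans (s-cong (s-value p)) (s-value (rotate p)))

    den-≉0 : ∀ j → value (den j) ≉ 0#
    den-≉0 0F = 0≉1 ∘ sym
    den-≉0 1F = 0≉1 ∘ sym
    den-≉0 2F = 0≉1 ∘ sym
    den-≉0 3F = y≉0
    den-≉0 4F = ≉-difference (x≉y ∘ sym)
    den-≉0 5F = ≉-difference (y≉z ∘ sym)

    point : Fin 6 → Carrier
    point j = value (num j) * value (den j) ⁻¹

    centre : Fin 3 → Carrier
    centre i = value (centreᵖ i)

    point-* : ∀ j → point j * value (den j) ≈ value (num j)
    point-* j = begin
      value (num j) * value (den j) ⁻¹ * value (den j)
        ≈⟨ solve 3 (λ a b c → a :* b :* c := a :* (c :* b)) refl _ _ _ ⟩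
      value (num j) * (value (den j) * value (den j) ⁻¹)
        ≈⟨ *-congˡ (⁻¹-inverseʳ (den-≉0 j)) ⟩
      value (num j) * 1#
        ≈⟨ *-identityʳ _ ⟩
      value (num j) ∎

    point-≉ : ∀ {i j} → i Fin.< j → point i ≉ point j
    point-≉ {i} {j} i<j eq = cross-≉0 i j i<j (begin
      nᵢ * dⱼ - nⱼ * dᵢ
        ≈⟨ +-cong (*-congʳ (point-* i)) (-‿cong (*-congʳ (point-* j))) ⟨
      point i * dᵢ * dⱼ - point j * dⱼ * dᵢ
        ≈⟨ +-congʳ (*-congʳ (*-congʳ eq)) ⟩
      point j * dᵢ * dⱼ - point j * dⱼ * dᵢ
        ≈⟨ solve 3 (λ p a b → p :* a :* b :- p :* b :* a := con 0ℤ) refl (point j) dᵢ dⱼ ⟩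
      0# ∎)
      where
      nᵢ = value (num i)
      nⱼ = value (num j)
      dᵢ = value (den i)
      dⱼ = value (den j)

    point-injective : ∀ i j → point i ≈ point j → i ≡ j
    point-injective i j eq with Finₚ.<-cmp i j
    ... | tri< i<j _ _ = contradiction eq (point-≉ i<j)
    ... | tri≈ _ i≡j _ = i≡j
    ... | tri> _ _ j<i = contradiction (sym eq) (point-≉ j<i)

    centre-injective : ∀ i j → centre i ≈ centre j → i ≡ j
    centre-injective 0F 0F eq = ≡.refl
    centre-injective 0F 1F eq = contradiction (sym eq) x≉0
    centre-injective 0F 2F eq = contradiction (sym eq) z≉0
    centre-injective 1F 0F eq = contradiction eq x≉0
    centre-injective 1F 1F eq = ≡.refl
    centre-injective 1F 2F eq = contradiction (sym eq) z≉x
    centre-injective 2F 0F eq = contradiction eq z≉0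
    centre-injective 2F 1F eq = contradiction eq z≉x
    centre-injective 2F 2F eq = ≡.refl

    defect≈0 : ∀ j → value (defect j) ≈ 0#
    defect≈0 0F = refl
    defect≈0 1F = trans (*-congˡ (trans (+-congʳ k²≈quad) (-‿inverseʳ Q))) (zeroʳ _)
    defect≈0 2F = trans (*-congˡ (trans (+-congʳ k²≈quad) (-‿inverseʳ Q))) (zeroʳ _)
    defect≈0 3F = refl
    defect≈0 4F = refl
    defect≈0 5F = refl

    weight : Fin 3 → Carrier
    weight i = value (weightᵖ i)

    xyz≉0 : x * y * z ≉ 0#
    xyz≉0 = *-≉0 (*-≉0 x≉0 y≉0) z≉0

    weight-≉0 : ∀ i → weight i ≉ 0#
    weight-≉0 0F = xyz≉0
    weight-≉0 1F = -‿≉0 xyz≉0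
    weight-≉0 2F = -‿≉0 xyz≉0

    s-xyz : s (x * y * z) ≈ x * y * z
    s-xyz = trans (s-value (weightᵖ 0F))
      (prove ρ (rotate (weightᵖ 0F)) (weightᵖ 0F) refl)

    s-weight : ∀ i → s (weight i) ≈ weight i
    s-weight 0F = s-xyz
    s-weight 1F = trans (s-neg _) (-‿cong s-xyz)
    s-weight 2F = trans (s-neg _) (-‿cong s-xyz)

    -- Multiplication by the nonzero norm of the denominator reduces this to `normᵖ-shifted`, whose
    -- defect vanishes because `k² = Q`.
    norm-point : ∀ i j → norm (point j + centre i) ≈ weight i
    norm-point i j = *-cancelˡ (norm-≉0 (den-≉0 j)) (begin
      norm d * norm (point j + centre i)      ≈⟨ norm-* _ _ ⟨
      norm (d * (point j + centre i))         ≈⟨ norm-cong (solve 3 (λ d p c →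
          d :* (p :+ c) := p :* d :+ c :* d) refl d _ _) ⟩
      norm (point j * d + centre i * d)       ≈⟨ norm-cong (+-congʳ (point-* j)) ⟩
      norm (value (num j) + centre i * d)     ≈⟨ norm-value (num j :+ centreᵖ i :* den j) ⟩
      value (shiftedˡ i j)                        ≈⟨ normᵖ-shifted i j ρ ⟩
      weight i * value (normᵖ (den j)) + value (defect j)
                                              ≈⟨ +-cong (*-congˡ (norm-value (den j))) (sym (defect≈0 j)) ⟨
      weight i * norm d + 0#                  ≈⟨ solve 2 (λ w d → w :* d :+ con 0ℤ := d :* w) refl _ _ ⟩
      norm d * weight i                       ∎)
      where d = value (den j)

-- Sums of simple fractions.

module PartialFractions {n} (F : FiniteField n) where
  open FiniteField F hiding (zero)
  open IntegerSolver cring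
  open FieldProperties F
  open import Relation.Binary.Reasoning.Setoid setoid

  -- (r , m) stands for the fraction m / (e - r).
  Fractions : Set
  Fractions = List (Carrier × Carrier)

  value numerator denominator : Fractions → Carrier → Carrier
  value []            e = 0#
  value ((r , m) ∷ L) e = m * (e - r) ⁻¹ + value L e
  denominator []            e = 1#
  denominator ((r , m) ∷ L) e = (e - r) * denominator L e
  numerator []            e = 0#
  numerator ((r , m) ∷ L) e = m * denominator L e + (e - r) * numerator L e

  residues : Fractions → Carrier
  residues []            = 0#
  residues ((r , m) ∷ L) = m + residues L

  degree-denominator : ∀ L → Degree (length L) 1# (denominator L)
  degree-denominator []            = constant λ _ → refl
  degree-denominator ((r , m) ∷ L) = degree-cong (*-identityˡ 1#) (λ _ → refl)
    (degree-* (degree-minus r degree-id) (degree-denominator L))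

  -- The extra factor `e` raises the degree to the number of poles, which also covers the empty
  -- list; the top coefficient is then the sum of the residues.
  degree-numerator : ∀ L → Degree (length L) (residues L) (λ e → e * numerator L e)
  degree-numerator []            = constant λ e → zeroʳ e
  degree-numerator ((r , m) ∷ L) = degree-cong (+-cong (*-identityʳ m) (*-identityˡ _))
    (λ e → solve 5 (λ e r m d k → m :* (e :* d) :+ (e :- r) :* (e :* k) := e :* (m :* d :+ (e :- r) :* k))
             refl e r m (denominator L e) (numerator L e))
    (degree-+ (degree-scale m (degree-shift (degree-denominator L)))
              (degree-* (degree-minus r degree-id) (degree-numerator L)))

  numerator≈ : ∀ L {e} → denominator L e ≉ 0# → numerator L e ≈ denominator L e * value L e
  numerator≈ []            d≉0 = sym (zeroʳ _)
  numerator≈ ((r , m) ∷ L) {e} d≉0 = sym (begin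
    (e - r) * d * (m * (e - r) ⁻¹ + value L e)
      ≈⟨ solve 5 (λ f d m i v → f :* d :* (m :* i :+ v) := m :* d :* (f :* i) :+ f :* (d :* v))
           refl (e - r) d m _ _ ⟩
    m * d * ((e - r) * (e - r) ⁻¹) + (e - r) * (d * value L e)
      ≈⟨ +-cong (*-congˡ (⁻¹-inverseʳ (≉0-*ˡ d≉0))) (*-congˡ (sym (numerator≈ L (≉0-*ʳ d≉0)))) ⟩
    m * d * 1# + (e - r) * numerator L e
      ≈⟨ +-congʳ (*-identityʳ _) ⟩
    m * d + (e - r) * numerator L e ∎)
    where d = denominator L e

  -- The product of `e`, numerator and denominator has degree twice the number of poles and top
  -- coefficient the sum of the residues. A non-root of it avoids the poles and the zeros of the
  -- fraction sum at once.
  value-nonzero : ∀ L → residues L ≉ 0# → length L ℕ.+ length L ℕ.< n →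
    ∃ λ e → denominator L e ≉ 0# × value L e ≉ 0#
  value-nonzero L res≉0 small
    with nonroot (degree-* (degree-numerator L) (degree-denominator L))
           (λ eq → res≉0 (trans (sym (*-identityʳ _)) eq)) small
  ... | e , prod≉0 = e , d≉0 , λ v≈0 → ≉0-*ʳ (≉0-*ˡ prod≉0)
          (trans (numerator≈ L d≉0) (trans (*-congˡ v≈0) (zeroʳ _)))
    where d≉0 = ≉0-*ʳ prod≉0

-- Inversion: from K_{3,6} to K_{4,6}.

-- The base copy, before translation and scaling. The coefficients 3 and 2 in `moment≉0` are chosen
-- so that translating four points by `d` and six by `-d` contributes nothing.
record Configuration {n} {F : FiniteField n} (σ : CubicAutomorphism F) : Set where
  open FiniteField F hiding (zero)
  open Norm σ
  field
    A a         : Fin 4 → Carrier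
    B b         : Fin 6 → Carrier
    A-injective : ∀ i j → A i ≈ A j → i ≡ j
    B-injective : ∀ i j → B i ≈ B j → i ≡ j
    s-a         : ∀ i → s (a i) ≈ a i
    s-b         : ∀ j → s (b j) ≈ b j
    a-≉0        : ∀ i → a i ≉ 0#
    b-≉0        : ∀ j → b j ≉ 0#
    norm-A+B    : ∀ i j → norm (A i + B j) ≈ a i * b j
    moment≉0    : (1# + 1# + 1#) * (A 0F + A 1F + A 2F + A 3F)
                  + (1# + 1#) * (B 0F + B 1F + B 2F + B 3F + B 4F + B 5F) ≉ 0#

module Inversion {n} {F : FiniteField n} (σ : CubicAutomorphism F) where
  open FiniteField F hiding (zero)
  open IntegerSolver cring
  open FieldProperties F
  open PartialFractions F
  open Norm σ
  open import Algebra.Properties.Ring ring using (-‿involutive; -0#≈0#; -‿injective)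
  open import Relation.Binary.Reasoning.Setoid setoid

  ⁻¹-injective : ∀ {x y} → x ≉ 0# → y ≉ 0# → x ⁻¹ ≈ y ⁻¹ → x ≈ y
  ⁻¹-injective {x} {y} x≉0 y≉0 eq = *-cancelˡ (⁻¹-≉0 x≉0) (begin
    x ⁻¹ * x   ≈⟨ trans (*-comm _ _) (⁻¹-inverseʳ x≉0) ⟩
    1#         ≈⟨ trans (*-comm _ _) (⁻¹-inverseʳ y≉0) ⟨
    y ⁻¹ * y   ≈⟨ *-congʳ eq ⟨
    x ⁻¹ * y   ∎)

  sub-injective : ∀ {e x y} → e - x ≈ e - y → x ≈ y
  sub-injective {e} {x} {y} eq = begin
    x            ≈⟨ solve 2 (λ e x → x := e :- (e :- x)) refl e x ⟩
    e - (e - x)  ≈⟨ +-congˡ (-‿cong eq) ⟩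
    e - (e - y)  ≈⟨ solve 2 (λ e x → e :- (e :- x) := x) refl e y ⟩
    y            ∎

  module _ (point : Fin 6 → Carrier) (centre weight : Fin 3 → Carrier)
    (point-injective : ∀ i j → point i ≈ point j → i ≡ j)
    (centre-injective : ∀ i j → centre i ≈ centre j → i ≡ j)
    (weight-≉0 : ∀ i → weight i ≉ 0#) (s-weight : ∀ i → s (weight i) ≈ weight i)
    (norm-point : ∀ i j → norm (point j + centre i) ≈ weight i)
    (3≉0 : 1# + 1# + 1# ≉ 0#) (18<n : 18 ℕ.< n) where

    -3# 2# : Carrier
    -3# = - (1# + 1# + 1#)
    2#  = 1# + 1#

    -- The moment of the inverted configuration as a function of `e`: each `A (suc i)` is
    -- `-1 / (e - centre i)` with coefficient 3, each `B j` is `1 / (e + point j)` with coefficient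
    -- 2. Nine poles account for the bound 18.
    poles : Fractions
    poles = (centre 0F , -3#) ∷ (centre 1F , -3#) ∷ (centre 2F , -3#)
          ∷ (- point 0F , 2#) ∷ (- point 1F , 2#) ∷ (- point 2F , 2#)
          ∷ (- point 3F , 2#) ∷ (- point 4F , 2#) ∷ (- point 5F , 2#) ∷ []

    -- Three residues `-3` and six residues 2 add up to 3.
    residues≉0 : residues poles ≉ 0#
    residues≉0 eq = 3≉0 (trans (sym (solve 0
      (let two = con 1ℤ :+ con 1ℤ
           -three = :- (con 1ℤ :+ con 1ℤ :+ con 1ℤ) in
       -three :+ (-three :+ (-three :+ (two :+ (two :+ (two :+ (two :+ (two :+ (two :+ con 0ℤ))))))))
         := con 1ℤ :+ con 1ℤ :+ con 1ℤ) refl)) eq)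

    module _ (e : Carrier) (den≉0 : denominator poles e ≉ 0#) (value≉0 : value poles e ≉ 0#) where

      e-centre≉0 : ∀ i → e - centre i ≉ 0#
      e-centre≉0 0F = ≉0-*ˡ den≉0
      e-centre≉0 1F = ≉0-*ˡ (≉0-*ʳ den≉0)
      e-centre≉0 2F = ≉0-*ˡ (≉0-*ʳ (≉0-*ʳ den≉0))

      e+point≉0 : ∀ j → e - - point j ≉ 0#
      e+point≉0 0F = ≉0-*ˡ (≉0-*ʳ (≉0-*ʳ (≉0-*ʳ den≉0)))
      e+point≉0 1F = ≉0-*ˡ (≉0-*ʳ (≉0-*ʳ (≉0-*ʳ (≉0-*ʳ den≉0))))
      e+point≉0 2F = ≉0-*ˡ (≉0-*ʳ (≉0-*ʳ (≉0-*ʳ (≉0-*ʳ (≉0-*ʳ den≉0)))))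
      e+point≉0 3F = ≉0-*ˡ (≉0-*ʳ (≉0-*ʳ (≉0-*ʳ (≉0-*ʳ (≉0-*ʳ (≉0-*ʳ den≉0))))))
      e+point≉0 4F = ≉0-*ˡ (≉0-*ʳ (≉0-*ʳ (≉0-*ʳ (≉0-*ʳ (≉0-*ʳ (≉0-*ʳ (≉0-*ʳ den≉0)))))))
      e+point≉0 5F = ≉0-*ˡ (≉0-*ʳ (≉0-*ʳ (≉0-*ʳ (≉0-*ʳ (≉0-*ʳ (≉0-*ʳ (≉0-*ʳ (≉0-*ʳ den≉0))))))))

      -- `A zero` is the image of the point at infinity; with weight 1 it forces `b j` to be the
      -- norm of `B j`.
      A a : Fin 4 → Carrier
      A zero    = 0#
      A (suc i) = - (e - centre i) ⁻¹
      a zero    = 1#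
      a (suc i) = norm (A (suc i)) * weight i

      B b : Fin 6 → Carrier
      B j = (e - - point j) ⁻¹
      b j = norm (B j)

      A-≉0 : ∀ i → A (suc i) ≉ 0#
      A-≉0 i eq = ⁻¹-≉0 (e-centre≉0 i) (trans (sym (-‿involutive _)) (trans (-‿cong eq) -0#≈0#))

      A-injective : ∀ i j → A i ≈ A j → i ≡ j
      A-injective zero    zero    eq = ≡.refl
      A-injective zero    (suc j) eq = contradiction (sym eq) (A-≉0 j)
      A-injective (suc i) zero    eq = contradiction eq (A-≉0 i)
      A-injective (suc i) (suc j) eq = ≡.cong suc (centre-injective i j
        (sub-injective (⁻¹-injective (e-centre≉0 i) (e-centre≉0 j) (-‿injective eq))))

      B-injective : ∀ i j → B i ≈ B j → i ≡ j
      B-injective i j eq = point-injective i j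
        (-‿injective (sub-injective (⁻¹-injective (e+point≉0 i) (e+point≉0 j) eq)))

      -- The difference of the reciprocals of `e + point j` and `e - centre i` has numerator
      -- `point j + centre i`, up to the sign carried by `A`. The norm of the sum thereby splits
      -- into a part depending on `i` and one depending on `j`.
      A+B : ∀ i j → A (suc i) + B j ≈ A (suc i) * B j * (point j + centre i)
      A+B i j = sym (begin
        - u * v * (point j + centre i)
          ≈⟨ solve 5 (λ u v p c e → :- u :* v :* (p :+ c)
                := v :* ((e :- c) :* u) :- u :* ((e :- :- p) :* v)) refl u v (point j) (centre i) e ⟩
        v * ((e - centre i) * u) - u * ((e - - point j) * v)
          ≈⟨ +-cong (*-congˡ (⁻¹-inverseʳ (e-centre≉0 i))) (-‿cong (*-congˡ (⁻¹-inverseʳ (e+point≉0 j)))) ⟩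
        v * 1# - u * 1#
          ≈⟨ solve 2 (λ u v → v :* con 1ℤ :- u :* con 1ℤ := :- u :+ v) refl u v ⟩
        - u + v ∎)
        where
        u = (e - centre i) ⁻¹
        v = B j

      norm-A+B : ∀ i j → norm (A i + B j) ≈ a i * b j
      norm-A+B zero    j = trans (norm-cong (+-identityˡ _)) (sym (*-identityˡ _))
      norm-A+B (suc i) j = begin
        norm (A (suc i) + B j)                                  ≈⟨ norm-cong (A+B i j) ⟩
        norm (A (suc i) * B j * (point j + centre i))           ≈⟨ trans (norm-* _ _) (*-congʳ (norm-* _ _)) ⟩
        norm (A (suc i)) * norm (B j) * norm (point j + centre i) ≈⟨ *-congˡ (norm-point i j) ⟩
        norm (A (suc i)) * norm (B j) * weight i                ≈⟨ solve 3 (λ x y z →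
            x :* y :* z := x :* z :* y) refl _ _ _ ⟩
        norm (A (suc i)) * weight i * norm (B j)                ∎

      moment : Carrier
      moment = (1# + 1# + 1#) * (A 0F + A 1F + A 2F + A 3F)
             + (1# + 1#) * (B 0F + B 1F + B 2F + B 3F + B 4F + B 5F)

      moment≈value : moment ≈ value poles e
      moment≈value = trans (+-congˡ (points (B 0F) (B 1F) (B 2F) (B 3F) (B 4F) (B 5F)))
        (centres ((e - centre 0F) ⁻¹) ((e - centre 1F) ⁻¹) ((e - centre 2F) ⁻¹) _)
        where
        centres : ∀ x₀ x₁ x₂ r → (1# + 1# + 1#) * (0# + - x₀ + - x₁ + - x₂) + r
          ≈ -3# * x₀ + (-3# * x₁ + (-3# * x₂ + r))
        centres = solve 4 (λ x₀ x₁ x₂ r →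
          let three = con 1ℤ :+ con 1ℤ :+ con 1ℤ in
          three :* (con 0ℤ :+ :- x₀ :+ :- x₁ :+ :- x₂) :+ r
          := :- three :* x₀ :+ (:- three :* x₁ :+ (:- three :* x₂ :+ r))) refl
        points : ∀ y₀ y₁ y₂ y₃ y₄ y₅ → 2# * (y₀ + y₁ + y₂ + y₃ + y₄ + y₅)
          ≈ 2# * y₀ + (2# * y₁ + (2# * y₂ + (2# * y₃ + (2# * y₄ + (2# * y₅ + 0#)))))
        points = solve 6 (λ y₀ y₁ y₂ y₃ y₄ y₅ →
          let two = con 1ℤ :+ con 1ℤ in
          two :* (y₀ :+ y₁ :+ y₂ :+ y₃ :+ y₄ :+ y₅)
          := two :* y₀ :+ (two :* y₁ :+ (two :* y₂
             :+ (two :* y₃ :+ (two :* y₄ :+ (two :* y₅ :+ con 0ℤ)))))) refl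

      s-a : ∀ i → s (a i) ≈ a i
      s-a zero    = s-1
      s-a (suc i) = trans (s-* _ _) (*-cong (s-norm _) (s-weight i))

      a-≉0 : ∀ i → a i ≉ 0#
      a-≉0 zero    = 0≉1 ∘ sym
      a-≉0 (suc i) = *-≉0 (norm-≉0 (A-≉0 i)) (weight-≉0 i)

      inverted : Configuration σ
      inverted = record
        { A = A ; a = a ; B = B ; b = b
        ; A-injective = A-injective ; B-injective = B-injective
        ; s-a = s-a ; s-b = λ j → s-norm (B j)
        ; a-≉0 = a-≉0 ; b-≉0 = λ j → norm-≉0 (⁻¹-≉0 (e+point≉0 j))
        ; norm-A+B = norm-A+B
        ; moment≉0 = λ eq → value≉0 (trans (sym moment≈value) eq) }

    configuration : Configuration σ
    configuration = let e , den≉0 , value≉0 = value-nonzero poles residues≉0 18<n in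
      inverted e den≉0 value≉0

-- Translated, scaled and reweighted copies.

module Copies (q : ℕ) (F : FiniteField (q ℕ.^ 3)) (σ : CubicAutomorphism F)
  (s≈pow : ∀ x → FiniteField._≈_ F (CubicAutomorphism.s σ x) (NormGraph.pow q F x q))
  (norm≈N : ∀ x → FiniteField._≈_ F (Norm.norm σ x) (NormGraph.N q F x))
  (conf : Configuration σ)
  (2≉0 : ¬ (FiniteField._≈_ F (FiniteField._+_ F (FiniteField.1# F) (FiniteField.1# F)) (FiniteField.0# F)))
  where
  open FiniteField F hiding (zero)
  open IntegerSolver cring
  open FieldProperties F
  open Norm σ
  open NormGraph q F
  open Configuration conf
  open import Algebra.Properties.CommutativeMonoid.Sum +-commutativeMonoid
    using (sum; sum-permute; sum-cong-≋)
  open import Algebra.Properties.Group +-group using () renaming (∙-cancelˡ to +-cancelˡ; ∙-cancelʳ to +-cancelʳ)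
  open import Relation.Binary.Reasoning.Setoid setoid

  -- Injectivity makes the two choice functions mutually inverse, so one family is a permutation of
  -- the other. Sums are thus invariants of a copy as an unordered subgraph.
  sum-matching : ∀ {m} {f g : Fin m → Carrier} →
    (∀ i j → f i ≈ f j → i ≡ j) → (∀ i j → g i ≈ g j → i ≡ j) →
    (∀ i → ∃ λ j → f i ≈ g j) → (∀ j → ∃ λ i → g j ≈ f i) → sum f ≈ sum g
  sum-matching {m} {f} {g} f-injective g-injective f⊆g g⊆f = sym (trans
    (sum-permute g π) (sum-cong-≋ λ i → sym (proj₂ (f⊆g i))))
    where
    π : Permutation m m
    π = permutation (proj₁ ∘ f⊆g) (proj₁ ∘ g⊆f)
      (λ j → g-injective _ _ (trans (sym (proj₂ (f⊆g _))) (sym (proj₂ (g⊆f j)))))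
      (λ i → f-injective _ _ (trans (sym (proj₂ (g⊆f _))) (sym (proj₂ (f⊆g i)))))

  half : Carrier
  half = (1# + 1#) ⁻¹

  Fixed : Carrier → Set
  Fixed a = s a ≈ a × a ≉ 0#

  fixed : ∀ a → Fixed a → InFq* a
  fixed a (sa≈a , a≉0) = trans (sym (s≈pow a)) sa≈a , a≉0

  fixed-* : ∀ {a b} → Fixed a → Fixed b → Fixed (a * b)
  fixed-* (sa , a≉0) (sb , b≉0) = trans (s-* _ _) (*-cong sa sb) , *-≉0 a≉0 b≉0

  fixed-norm : ∀ {c} → c ≉ 0# → Fixed (norm c)
  fixed-norm c≉0 = s-norm _ , norm-≉0 c≉0

  fixed-⁻¹ : ∀ {a} → Fixed a → Fixed (a ⁻¹)
  fixed-⁻¹ {a} (sa≈a , a≉0) = *-cancelˡ a≉0 (begin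
    a * s (a ⁻¹)     ≈⟨ *-congʳ sa≈a ⟨
    s a * s (a ⁻¹)   ≈⟨ s-* _ _ ⟨
    s (a * a ⁻¹)     ≈⟨ s-cong (⁻¹-inverseʳ a≉0) ⟩
    s 1#             ≈⟨ s-1 ⟩
    1#               ≈⟨ ⁻¹-inverseʳ a≉0 ⟨
    a * a ⁻¹         ∎) , ⁻¹-≉0 a≉0

  -- The translations d excluded here are those for which some A i + d and B j - d coincide.
  Good : Carrier → Set
  Good d = ∀ i j → d ≉ half * (B j - A i)

  record Parameters : Set where
    field
      c t d   : Carrier
      c≉0     : c ≉ 0#
      t-fixed : Fixed t
      good    : Good d

  module Copy (π : Parameters) where
    open Parameters π public

    left : Fin 4 → Carrier
    left i = c * (A i + d)

    right : Fin 6 → Carrier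
    right j = c * (B j - d)

    S : Fin 4 → Vertex
    S i = left i , norm c * t * a i ,
      fixed _ (fixed-* (fixed-* (fixed-norm c≉0) t-fixed) (s-a i , a-≉0 i))

    T : Fin 6 → Vertex
    T j = right j , t ⁻¹ * b j , fixed _ (fixed-* (fixed-⁻¹ t-fixed) (s-b j , b-≉0 j))

    left-injective : ∀ i j → left i ≈ left j → i ≡ j
    left-injective i j eq = A-injective i j (+-cancelʳ d _ _ (*-cancelˡ c≉0 eq))

    right-injective : ∀ i j → right i ≈ right j → i ≡ j
    right-injective i j eq = B-injective i j (+-cancelʳ (- d) _ _ (*-cancelˡ c≉0 eq))

    -- Cancelling `c`, a coincidence reads `A i + d = B j - d`, so `d` would be the excluded half
    -- difference.
    left≉right : ∀ i j → left i ≉ right j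
    left≉right i j eq = good i j (begin
      d                                ≈⟨ *-identityˡ d ⟨
      1# * d                           ≈⟨ *-congʳ (⁻¹-inverseʳ 2≉0) ⟨
      (1# + 1#) * half * d             ≈⟨ solve 3 (λ h d a → (con 1ℤ :+ con 1ℤ) :* h :* d
                                            := h :* ((a :+ d) :- a :+ d)) refl half d (A i) ⟩
      half * ((A i + d) - A i + d)     ≈⟨ *-congˡ (+-congʳ (+-congʳ (*-cancelˡ c≉0 eq))) ⟩
      half * ((B j - d) - A i + d)     ≈⟨ *-congˡ (solve 3 (λ a b d → (b :- d) :- a :+ d := b :- a)
                                            refl (A i) (B j) d) ⟩
      half * (B j - A i)               ∎)

    product-of-weights : ∀ i j → norm c * t * a i * (t ⁻¹ * b j) ≈ norm c * (a i * b j)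
    product-of-weights i j = begin
      norm c * t * a i * (t ⁻¹ * b j)
        ≈⟨ solve 5 (λ n t a u b → n :* t :* a :* (u :* b) := (t :* u) :* (n :* (a :* b)))
             refl (norm c) t (a i) (t ⁻¹) (b j) ⟩
      t * t ⁻¹ * (norm c * (a i * b j))
        ≈⟨ *-congʳ (⁻¹-inverseʳ (proj₂ t-fixed)) ⟩
      1# * (norm c * (a i * b j))
        ≈⟨ *-identityˡ _ ⟩
      norm c * (a i * b j) ∎

    -- The translations cancel in the sum, the scale factors out through its norm, and `t` cancels
    -- against its inverse.
    edge : ∀ i j → N (left i + right j) ≈ norm c * t * a i * (t ⁻¹ * b j)
    edge i j = begin
      N (left i + right j)         ≈⟨ norm≈N _ ⟨
      norm (left i + right j)      ≈⟨ norm-cong (solve 4 (λ c a b d → c :* (a :+ d) :+ c :* (b :- d)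
                                        := c :* (a :+ b)) refl c (A i) (B j) d) ⟩
      norm (c * (A i + B j))       ≈⟨ norm-* _ _ ⟩
      norm c * norm (A i + B j)    ≈⟨ *-congˡ (norm-A+B i j) ⟩
      norm c * (a i * b j)         ≈⟨ product-of-weights i j ⟨
      norm c * t * a i * (t ⁻¹ * b j) ∎

    copy : K46
    copy = record
      { S = S ; T = T
      ; S-distinct  = λ i j i≢j → i≢j ∘ left-injective i j ∘ proj₁
      ; T-distinct  = λ i j i≢j → i≢j ∘ right-injective i j ∘ proj₁
      ; ST-distinct = λ i j → left≉right i j ∘ proj₁
      ; complete    = λ i j → left≉right i j ∘ proj₁ , edge i j }

    leftA rightB moment : Carrier
    leftA  = A 0F + A 1F + A 2F + A 3F
    rightB = B 0F + B 1F + B 2F + B 3F + B 4F + B 5F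
    moment = (1# + 1# + 1#) * leftA + (1# + 1#) * rightB

    -- The term `4d` is kept as `2 * (2 * d)` so that it can be cancelled by using `2≉0` twice.
    sum-left : sum left ≈ c * (leftA + (1# + 1#) * ((1# + 1#) * d))
    sum-left = solve 6 (λ c d a₀ a₁ a₂ a₃ →
        c :* (a₀ :+ d) :+ (c :* (a₁ :+ d) :+ (c :* (a₂ :+ d) :+ (c :* (a₃ :+ d) :+ con 0ℤ)))
        := c :* (a₀ :+ a₁ :+ a₂ :+ a₃ :+ (con 1ℤ :+ con 1ℤ) :* ((con 1ℤ :+ con 1ℤ) :* d)))
      refl c d (A 0F) (A 1F) (A 2F) (A 3F)

    sum-right : sum right ≈ c * (rightB - (1# + 1# + 1#) * ((1# + 1#) * d))
    sum-right = trans
      (solve 7 (λ c b₀ b₁ b₂ b₃ b₄ b₅ →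
          c :* b₀ :+ (c :* b₁ :+ (c :* b₂ :+ (c :* b₃ :+ (c :* b₄ :+ (c :* b₅ :+ con 0ℤ)))))
          := c :* (b₀ :+ b₁ :+ b₂ :+ b₃ :+ b₄ :+ b₅))
        refl c (B 0F - d) (B 1F - d) (B 2F - d) (B 3F - d) (B 4F - d) (B 5F - d))
      (*-congˡ (solve 7 (λ d b₀ b₁ b₂ b₃ b₄ b₅ →
          (b₀ :- d) :+ (b₁ :- d) :+ (b₂ :- d) :+ (b₃ :- d) :+ (b₄ :- d) :+ (b₅ :- d)
          := b₀ :+ b₁ :+ b₂ :+ b₃ :+ b₄ :+ b₅
             :- (con 1ℤ :+ con 1ℤ :+ con 1ℤ) :* ((con 1ℤ :+ con 1ℤ) :* d))
        refl d (B 0F) (B 1F) (B 2F) (B 3F) (B 4F) (B 5F)))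

    -- 3 · 4 d = 2 · 6 d, so this combination of the two sums does not depend on d.
    sum-moment : (1# + 1# + 1#) * sum left + (1# + 1#) * sum right ≈ moment * c
    sum-moment = trans (+-cong (*-congˡ sum-left) (*-congˡ sum-right))
      (solve 4 (λ c d a b →
          let two = con 1ℤ :+ con 1ℤ
              three = con 1ℤ :+ con 1ℤ :+ con 1ℤ in
          three :* (c :* (a :+ two :* (two :* d))) :+ two :* (c :* (b :- three :* (two :* d)))
          := (three :* a :+ two :* b) :* c)
        refl c d leftA rightB)

  module _ (π π′ : Parameters) (same : SameK46 (Copy.copy π) (Copy.copy π′)) where
    private
      module P  = Copy π
      module P′ = Copy π′

    same-left : sum P.left ≈ sum P′.left
    same-left = let f , g , _ , _ = same in sum-matching P.left-injective P′.left-injective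
      (λ i → proj₁ (f i) , proj₁ (proj₂ (f i))) (λ i → proj₁ (g i) , proj₁ (proj₂ (g i)))

    same-right : sum P.right ≈ sum P′.right
    same-right = let _ , _ , f , g = same in sum-matching P.right-injective P′.right-injective
      (λ i → proj₁ (f i) , proj₁ (proj₂ (f i))) (λ i → proj₁ (g i) , proj₁ (proj₂ (g i)))

    same-c : P.c ≈ P′.c
    -- Both moments are the same expression in the fixed configuration, so the nonzero common factor
    -- cancels.
    same-c = *-cancelˡ moment≉0 (begin
      P.moment * P.c                                              ≈⟨ P.sum-moment ⟨
      (1# + 1# + 1#) * sum P.left + (1# + 1#) * sum P.right       ≈⟨ +-cong (*-congˡ same-left) (*-congˡ same-right) ⟩
      (1# + 1# + 1#) * sum P′.left + (1# + 1#) * sum P′.right     ≈⟨ P′.sum-moment ⟩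
      P′.moment * P′.c                                            ∎)

    same-d : P.d ≈ P′.d
    same-d = *-cancelˡ 2≉0 (*-cancelˡ 2≉0 (+-cancelˡ P.leftA _ _ (*-cancelˡ P.c≉0 (begin
      P.c * (P.leftA + (1# + 1#) * ((1# + 1#) * P.d))       ≈⟨ P.sum-left ⟨
      sum P.left                                            ≈⟨ same-left ⟩
      sum P′.left                                           ≈⟨ P′.sum-left ⟩
      P′.c * (P.leftA + (1# + 1#) * ((1# + 1#) * P′.d))     ≈⟨ *-congʳ same-c ⟨
      P.c * (P.leftA + (1# + 1#) * ((1# + 1#) * P′.d))      ∎))))

    same-t : P.t ≈ P′.t
    same-t = *-cancelˡ (norm-≉0 P.c≉0) (*-cancelˡ (a-≉0 0F) (begin
      a 0F * (norm P.c * P.t)       ≈⟨ *-comm _ _ ⟩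
      norm P.c * P.t * a 0F         ≈⟨ same-weight ⟩
      norm P′.c * P′.t * a 0F       ≈⟨ *-congʳ (*-congʳ (norm-cong same-c)) ⟨
      norm P.c * P′.t * a 0F        ≈⟨ *-comm _ _ ⟩
      a 0F * (norm P.c * P′.t)      ∎))
      where
      partner : Fin 4
      partner = proj₁ (proj₁ same 0F)
      same-left₀ : P.left 0F ≈ P′.left partner
      same-left₀ = proj₁ (proj₂ (proj₁ same 0F))
      same-weight′ : norm P.c * P.t * a 0F ≈ norm P′.c * P′.t * a partner
      same-weight′ = proj₂ (proj₂ (proj₁ same 0F))
      -- Once `c` and `d` agree, the two left families agree index by index, so vertex 0 can only be
      -- matched with vertex 0.
      0≡partner : 0F ≡ partner
      0≡partner = P′.left-injective 0F partner
        (trans (*-cong (sym same-c) (+-congˡ (sym same-d))) same-left₀)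
      same-weight : norm P.c * P.t * a 0F ≈ norm P′.c * P′.t * a 0F
      same-weight = trans same-weight′ (*-congˡ (reflexive (≡.cong a (≡.sym 0≡partner))))

-- Numerical estimates.

open import Data.Nat using (_^_; _*_; _∸_; _≥_)

distinct-primes-coprime : ∀ {r p} → Prime r → Prime p → p ≢ r → Coprime r p
distinct-primes-coprime r-prime p-prime p≢r (d∣r , d∣p)
  with prime⇒irreducible r-prime d∣r | prime⇒irreducible p-prime d∣p
... | inj₁ d≡1 | _        = d≡1
... | inj₂ _   | inj₁ d≡1 = d≡1
... | inj₂ d≡r | inj₂ d≡p = contradiction (≡.trans (≡.sym d≡p) d≡r) p≢r

m*[m*m]≡m^3 : ∀ m → m * (m * m) ≡ m ^ 3
m*[m*m]≡m^3 m = ≡.cong (λ l → m * (m * l)) (≡.sym (ℕₚ.*-identityʳ m))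

-- From `m³ - 1 = (m - 1)(1 + m + m²)`. It is the degree bound for finding a norm different from 0
-- and from `r` earlier values.
[1+r]*[1+m+m²]<m³ : ∀ {m r} → r ℕ.< m ∸ 1 → suc r * (1 ℕ.+ m ℕ.+ m * m) ℕ.< m ^ 3
[1+r]*[1+m+m²]<m³ {suc m} {r} r<m =
  ≡.subst (suc r * (1 ℕ.+ suc m ℕ.+ suc m * suc m) ℕ.<_)
    (≡.trans (≡.sym (difference-of-cubes m)) (m*[m*m]≡m^3 (suc m)))
    (s≤s (ℕₚ.*-monoˡ-≤ (1 ℕ.+ suc m ℕ.+ suc m * suc m) r<m))
  where
  difference-of-cubes : ∀ m → suc m * (suc m * suc m) ≡ suc (m * (1 ℕ.+ suc m ℕ.+ suc m * suc m))
  difference-of-cubes = solve-∀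

-- The degree bound for avoiding `l` forbidden and `r` chosen elements; the factor 1 is the degree
-- of the identity function.
[l+r]*1<m : ∀ {l r m} → l ℕ.≤ m → r ℕ.< m ∸ l → (l ℕ.+ r) * 1 ℕ.< m
[l+r]*1<m {l} {r} {m} l≤m r<m∸l = ≡.subst (ℕ._< m) (≡.sym (ℕₚ.*-identityʳ (l ℕ.+ r)))
  (≡.subst (ℕ._≤ m) (≡.cong suc (ℕₚ.+-comm r l)) (ℕₚ.m≤o∸n⇒m+n≤o (suc r) l≤m r<m∸l))

4≤prime : ∀ {p} → Prime p → p ≢ 2 → p ≢ 3 → 4 ℕ.≤ p
4≤prime {0} p-prime _ _ = contradiction p-prime ¬prime[0]
4≤prime {1} p-prime _ _ = contradiction p-prime ¬prime[1]
4≤prime {2} _ p≢2 _ = contradiction ≡.refl p≢2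
4≤prime {3} _ _ p≢3 = contradiction ≡.refl p≢3
4≤prime {suc (suc (suc (suc _)))} _ _ _ = s≤s (s≤s (s≤s (s≤s z≤n)))

-- Characteristic and Frobenius map of the field with q³ elements.

module PrimePower (p k : ℕ) (p-prime : Prime p) (F : FiniteField ((p ^ k) ^ 3)) where
  open FiniteField F hiding (zero; _*_)
  open FiniteField F using () renaming (_*_ to _·_)
  open IntegerSolver cring
  open FieldProperties F
  open NormGraph (p ^ k) F
  open Frobenius cring
  open import Algebra.Properties.Semiring.Exp semiring using (^-homo-*; ^-assocʳ; ^-congˡ; ^-congʳ)
    renaming (_^_ to _**_)
  open import Algebra.Properties.CommutativeSemiring.Exp commutativeSemiring using (^-distrib-*)
  open import Algebra.Properties.Semiring.Mult semiring using (×1-homo-*; ×-congˡ)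
    renaming (_×_ to _×ₙ_)
  open import Relation.Binary.Reasoning.Setoid setoid

  q : ℕ
  q = p ^ k

  ^-×1 : ∀ m j → (m ^ j) ×ₙ 1# ≈ (m ×ₙ 1#) ** j
  ^-×1 m zero    = +-identityʳ 1#
  ^-×1 m (suc j) = trans (×1-homo-* m (m ^ j)) (*-congˡ (^-×1 m j))

  -- The multiple `q³` of 1 vanishes and is a power of `p ×ₙ 1#`; a power of a nonzero element is
  -- nonzero.
  p×1≈0 : p ×ₙ 1# ≈ 0#
  p×1≈0 with (p ×ₙ 1#) ≟ 0#
  ... | yes p≈0 = p≈0
  ... | no p≉0  = contradiction (trans (sym q³×1) n·1≈0) (^-≉0 3 (^-≉0 k p≉0))
    where
    q³×1 : (q ^ 3) ×ₙ 1# ≈ ((p ×ₙ 1#) ** k) ** 3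
    q³×1 = trans (^-×1 q 3) (^-congˡ 3 (^-×1 p k))

  multiple-≈0 : ∀ x m → m ×ₙ 1# ≈ 0# → (x * m) ×ₙ 1# ≈ 0#
  multiple-≈0 x m m≈0 = trans (×1-homo-* x m) (trans (*-congˡ m≈0) (zeroʳ _))

  bézout-≈ : ∀ x l y m → 1 ℕ.+ y * m ≡ x * l → l ×ₙ 1# ≈ 0# → m ×ₙ 1# ≈ 0# → 0# ≈ 1#
  bézout-≈ x l y m eq l≈0 m≈0 = begin
    0#                         ≈⟨ multiple-≈0 x l l≈0 ⟨
    (x * l) ×ₙ 1#              ≈⟨ ×-congˡ eq ⟨
    1# + (y * m) ×ₙ 1#         ≈⟨ +-congˡ (multiple-≈0 y m m≈0) ⟩
    1# + 0#                    ≈⟨ +-identityʳ 1# ⟩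
    1#                         ∎

  -- If two coprime integers both vanished in the field, a Bézout relation would give `0 = 1`.
  other-prime-≉0 : ∀ {r} → Prime r → p ≢ r → r ×ₙ 1# ≉ 0#
  other-prime-≉0 {r} r-prime p≢r r≈0
    with coprime-Bézout (distinct-primes-coprime r-prime p-prime p≢r)
  ... | Bézout.+- x y eq = 0≉1 (bézout-≈ x r y p eq r≈0 p×1≈0)
  ... | Bézout.-+ x y eq = 0≉1 (bézout-≈ y p x r eq p×1≈0 r≈0)

  frobenius-power-+ : ∀ j x y → (x + y) ** (p ^ j) ≈ x ** (p ^ j) + y ** (p ^ j)
  frobenius-power-+ zero    x y = trans (*-identityʳ _) (sym (+-cong (*-identityʳ x) (*-identityʳ y)))
  frobenius-power-+ (suc j) x y = begin
    (x + y) ** (p * p ^ j)                   ≈⟨ ^-assocʳ (x + y) p (p ^ j) ⟨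
    ((x + y) ** p) ** (p ^ j)                ≈⟨ ^-congˡ (p ^ j) (frobenius-+ p-prime p×1≈0 x y) ⟩
    (x ** p + y ** p) ** (p ^ j)             ≈⟨ frobenius-power-+ j (x ** p) (y ** p) ⟩
    (x ** p) ** (p ^ j) + (y ** p) ** (p ^ j) ≈⟨ +-cong (^-assocʳ x p (p ^ j)) (^-assocʳ y p (p ^ j)) ⟩
    x ** (p * p ^ j) + y ** (p * p ^ j)      ∎

  pow≡** : ∀ x m → pow x m ≡ x ** m
  pow≡** x zero    = ≡.refl
  pow≡** x (suc m) = ≡.cong (x ·_) (pow≡** x m)

  1** : ∀ m → 1# ** m ≈ 1#
  1** zero    = refl
  1** (suc m) = trans (*-identityˡ _) (1** m)

  σ : CubicAutomorphism F
  σ = record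
    { s      = _** q
    ; s-cong = ^-congˡ q
    ; s-+    = frobenius-power-+ k
    ; s-*    = λ x y → ^-distrib-* x y q
    ; s-1    = 1** q
    -- Three applications raise to the power `q³`, the size of the field, which fixes every element.
    ; s³≈id  = λ x → begin
        ((x ** q) ** q) ** q  ≈⟨ trans (^-congˡ q (^-assocʳ x q q)) (^-assocʳ x (q * q) q) ⟩
        x ** (q * q * q)      ≈⟨ ^-congʳ x (≡.trans (ℕₚ.*-assoc q q q) (m*[m*m]≡m^3 q)) ⟩
        x ** (q ^ 3)          ≈⟨ xⁿ≈x x ⟩
        x                     ∎ }

  open Norm σ

  norm≈** : ∀ x → norm x ≈ x ** (1 ℕ.+ q ℕ.+ q * q)
  norm≈** x = begin
    x · x ** q · (x ** q) ** q     ≈⟨ *-congˡ (^-assocʳ x q q) ⟩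
    x · x ** q · x ** (q * q)      ≈⟨ ^-homo-* x (suc q) (q * q) ⟨
    x ** (1 ℕ.+ q ℕ.+ q * q)       ∎

  s≈pow : ∀ x → s x ≈ pow x q
  s≈pow x = reflexive (≡.sym (pow≡** x q))

  norm≈N : ∀ x → norm x ≈ N x
  norm≈N x = trans (norm≈** x) (reflexive (≡.sym (pow≡** x (1 ℕ.+ q ℕ.+ q * q))))

  degree-difference : ∀ {d l m f g} → Degree d l f → Degree d m g →
    Degree d (l - m) (λ x → f x - g x)
  degree-difference D E = degree-cong (+-congˡ (minus _)) (λ x → +-congˡ (minus _))
    (degree-+ D (degree-scale (- 1#) E))
    where
    minus : ∀ x → - 1# · x ≈ - x
    minus = solve 1 (λ x → :- con 1ℤ :* x := :- x) refl

  quad : Carrier → Carrier → Carrier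
  quad x y = x · x + x · y + y · y

  -- An element of trace zero and the resulting x, y, k.

  module Trace (2<q : 2 ℕ.< q) where

    1<q : 1 ℕ.< q
    1<q = ℕₚ.<-trans (s≤s (s≤s z≤n)) 2<q

    instance
      q≢0 : ℕ.NonZero q
      q≢0 = ℕ.>-nonZero (ℕₚ.<-trans (s≤s z≤n) 1<q)

      q*q≢0 : ℕ.NonZero (q * q)
      q*q≢0 = ℕₚ.m*n≢0 q q

    q<q*q : q ℕ.< q * q
    q<q*q = ℕₚ.m<m*n q q 1<q

    2q²<q³ : q * q ℕ.+ q * q ℕ.< q ^ 3
    2q²<q³ = ≡.subst₂ ℕ._<_ (≡.cong (q * q ℕ.+_) (ℕₚ.+-identityʳ (q * q))) (m*[m*m]≡m^3 q)
      (ℕₚ.*-monoˡ-< (q * q) 2<q)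

    -- In `u` the second argument is monic of degree `q²`, while the first has smaller degree. The
    -- form is therefore monic of degree `2q²`, which is below `q³` because `2 < q`.
    trace-quad : ∃ λ u → quad (s u - u) (s (s u) - s u) ≉ 0#
    trace-quad = nonroot
      (degree-+ (degree-+ (degree-* D₁ D₁) (degree-* D₁ D₂)) (degree-* D₂ D₂))
      (λ eq → 0≉1 (trans (sym eq) leading)) 2q²<q³
      where
      D₁ : Degree (q * q) (0# - 0#) (λ u → s u - u)
      D₁ = degree-difference (degree-< q<q*q (degree-^ q)) (degree-< (ℕₚ.<-trans 1<q q<q*q) degree-id)
      D₂ : Degree (q * q) (1# - 0#) (λ u → s (s u) - s u)
      D₂ = degree-difference
        (degree-cong refl (λ u → sym (^-assocʳ u q q)) (degree-^ (q * q)))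
        (degree-< q<q*q (degree-^ q))
      leading : (0# - 0#) · (0# - 0#) + (0# - 0#) · (1# - 0#) + (1# - 0#) · (1# - 0#) ≈ 1#
      leading = solve 0 (let o = con 0ℤ :- con 0ℤ
                             i = con 1ℤ :- con 0ℤ in
        o :* o :+ o :* i :+ i :* i := con 1ℤ) refl

    -- An element `s u - u` has trace zero, so the third conjugate of `a` is `- (a + b)`; `κ` plays
    -- the part of `k`.
    u a b x y κ : Carrier
    u = proj₁ trace-quad
    a = s u - u
    b = s (s u) - s u
    x = a · (- (a + b) - b)
    y = b · (a - - (a + b))
    κ = quad a b

    sa≈b : s a ≈ b
    sa≈b = s-difference (s u) u

    sb≈-a-b : s b ≈ - (a + b)
    sb≈-a-b = begin
      s b                 ≈⟨ s-difference (s (s u)) (s u) ⟩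
      s (s (s u)) - s (s u) ≈⟨ +-congʳ (s³≈id u) ⟩
      u - s (s u)         ≈⟨ solve 3 (λ u v w →
          u :- w := :- ((v :- u) :+ (w :- v))) refl u (s u) (s (s u)) ⟩
      - (a + b)           ∎

    s-a+b : s (- (a + b)) ≈ a
    s-a+b = begin
      s (- (a + b))       ≈⟨ trans (s-neg _) (-‿cong (trans (s-+ a b) (+-cong sa≈b sb≈-a-b))) ⟩
      - (b + - (a + b))   ≈⟨ solve 2 (λ a b → :- (b :+ :- (a :+ b)) := a) refl a b ⟩
      a                   ∎

    sx≈y : s x ≈ y
    sx≈y = trans (s-* _ _) (*-cong sa≈b
      (trans (s-difference _ _) (+-cong s-a+b (-‿cong sb≈-a-b))))

    sy≈z : s y ≈ - (x + y)
    sy≈z = begin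
      s y                      ≈⟨ trans (s-* _ _) (*-cong sb≈-a-b
                                    (trans (s-difference _ _) (+-cong sa≈b (-‿cong s-a+b)))) ⟩
      - (a + b) · (b - a)      ≈⟨ solve 2 (λ a b → :- (a :+ b) :* (b :- a)
                                    := :- (a :* (:- (a :+ b) :- b) :+ b :* (a :- :- (a :+ b)))) refl a b ⟩
      - (x + y)                ∎

    sκ≈κ : s κ ≈ κ
    sκ≈κ = begin
      s κ                      ≈⟨ trans (s-+ _ _) (+-cong (trans (s-+ _ _) (+-cong (s-* a a) (s-* a b))) (s-* b b)) ⟩
      quad (s a) (s b)         ≈⟨ +-cong (+-cong (*-cong sa≈b sa≈b) (*-cong sa≈b sb≈-a-b)) (*-cong sb≈-a-b sb≈-a-b) ⟩
      quad b (- (a + b))       ≈⟨ solve 2 (λ a b → b :* b :+ b :* :- (a :+ b) :+ :- (a :+ b) :* :- (a :+ b)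
                                    := a :* a :+ a :* b :+ b :* b) refl a b ⟩
      κ                        ∎

    -- The purpose of passing from `a`, `b` to `x`, `y`: the form becomes the square of an explicit
    -- element fixed by `s`, and no square root has to be chosen.
    κ²≈quad : κ · κ ≈ quad x y
    κ²≈quad = solve 2 (λ a b →
      let κ = a :* a :+ a :* b :+ b :* b
          x = a :* (:- (a :+ b) :- b)
          y = b :* (a :- :- (a :+ b)) in
      κ :* κ := x :* x :+ x :* y :+ y :* y) refl a b

    κ≉0 : κ ≉ 0#
    κ≉0 = proj₂ trace-quad

  avoid₂ : ∀ {l r d f} → Degree (suc d) 1# f → (u : Fin l → Carrier) (v : Fin r → Carrier) →
    (l ℕ.+ r) * suc d ℕ.< q ^ 3 → ∃ λ x → (∀ i → f x ≉ u i) × (∀ i → f x ≉ v i)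
  avoid₂ D u v small = let x , x≉ = avoid D (u ++ v) small in x
    , (λ i eq → x≉ (i ↑ˡ _) (trans eq (reflexive (≡.sym (lookup-++ˡ u v i)))))
    , (λ i eq → x≉ (_ ↑ʳ i) (trans eq (reflexive (≡.sym (lookup-++ʳ u v i)))))

  -- Counting the parameters.

  module Counting (conf : Configuration σ) (2≉0 : 1# + 1# ≉ 0#) (24≤n : 24 ℕ.≤ q ^ 3) where
    open Copies q F σ s≈pow norm≈N conf 2≉0
    open Configuration conf

    zeroVector : Fin 1 → Carrier
    zeroVector _ = 0#

    scales : ∃ λ (v : Fin (q ^ 3 ∸ 1) → Carrier) → (∀ i → v i ≉ 0#) × (∀ i j → v i ≈ v j → i ≡ j)
    scales = select {_≉ 0#} (q ^ 3 ∸ 1) λ r< v →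
      let x , x≉0 , x≉v = avoid₂ degree-id zeroVector v
            ([l+r]*1<m (ℕₚ.≤-trans (s≤s z≤n) 24≤n) r<)
      in x , x≉0 0F , x≉v

    -- The norms supply the q - 1 nonzero fixed elements.
    factors : ∃ λ (v : Fin (q ∸ 1) → Carrier) → (∀ i → Fixed (v i)) × (∀ i j → v i ≈ v j → i ≡ j)
    factors = select {Fixed} (q ∸ 1) λ r< v →
      let x , x≉0 , x≉v = avoid₂ (degree-^ (1 ℕ.+ q ℕ.+ q * q)) zeroVector v ([1+r]*[1+m+m²]<m³ {q} r<)
      in norm x
       , (s-norm x , λ eq → x≉0 0F (trans (sym (norm≈** x)) eq))
       , λ i eq → x≉v i (trans (sym (norm≈** x)) eq)

    -- One excluded translation for each of the `4 * 6` pairs; the quotient by 6 indexes `A` and the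
    -- remainder `B`.
    bad : Fin 24 → Carrier
    bad i = let j , k = remQuot 6 i in half · (B k - A j)

    bad-combine : ∀ i j → bad (combine i j) ≡ half · (B j - A i)
    bad-combine i j = ≡.cong (λ jk → half · (B (proj₂ jk) - A (proj₁ jk))) (Finₚ.remQuot-combine i j)

    translations : ∃ λ (v : Fin (q ^ 3 ∸ 24) → Carrier) → (∀ i → Good (v i)) × (∀ i j → v i ≈ v j → i ≡ j)
    translations = select {Good} (q ^ 3 ∸ 24) λ r< v →
      let x , x≉bad , x≉v = avoid₂ degree-id bad v ([l+r]*1<m 24≤n r<)
      in x , (λ i j eq → x≉bad (combine i j) (trans eq (reflexive (≡.sym (bad-combine i j))))) , x≉v

    Index : Set
    Index = Fin ((q ^ 3 ∸ 1) * (q ∸ 1) * (q ^ 3 ∸ 24))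

    scale-factor : Index → Fin ((q ^ 3 ∸ 1) * (q ∸ 1))
    scale-factor i = proj₁ (remQuot (q ^ 3 ∸ 24) i)

    scaleIndex : Index → Fin (q ^ 3 ∸ 1)
    scaleIndex i = proj₁ (remQuot (q ∸ 1) (scale-factor i))

    factorIndex : Index → Fin (q ∸ 1)
    factorIndex i = proj₂ (remQuot {q ^ 3 ∸ 1} (q ∸ 1) (scale-factor i))

    translationIndex : Index → Fin (q ^ 3 ∸ 24)
    translationIndex i = proj₂ (remQuot {(q ^ 3 ∸ 1) * (q ∸ 1)} (q ^ 3 ∸ 24) i)

    remQuot-injective : ∀ {m} l (i j : Fin (m * l)) →
      proj₁ (remQuot {m} l i) ≡ proj₁ (remQuot {m} l j) →
      proj₂ (remQuot {m} l i) ≡ proj₂ (remQuot {m} l j) → i ≡ j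
    remQuot-injective {m} l i j eq₁ eq₂ = ≡.trans (≡.sym (Finₚ.combine-remQuot {m} l i))
      (≡.trans (≡.cong₂ combine eq₁ eq₂) (Finₚ.combine-remQuot {m} l j))

    index-injective : ∀ i j → scaleIndex i ≡ scaleIndex j → factorIndex i ≡ factorIndex j →
      translationIndex i ≡ translationIndex j → i ≡ j
    index-injective i j eq₁ eq₂ eq₃ = remQuot-injective {(q ^ 3 ∸ 1) * (q ∸ 1)} (q ^ 3 ∸ 24) i j
      (remQuot-injective {q ^ 3 ∸ 1} (q ∸ 1) (scale-factor i) (scale-factor j) eq₁ eq₂) eq₃

    parameters : Index → Parameters
    parameters i = record
      { c = proj₁ scales (scaleIndex i)
      ; t = proj₁ factors (factorIndex i)
      ; d = proj₁ translations (translationIndex i)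
      ; c≉0     = proj₁ (proj₂ scales) (scaleIndex i)
      ; t-fixed = proj₁ (proj₂ factors) (factorIndex i)
      ; good    = proj₁ (proj₂ translations) (translationIndex i) }

    atLeastK46 : AtLeastK46 ((q ^ 3 ∸ 1) * (q ∸ 1) * (q ^ 3 ∸ 24))
    atLeastK46 = (λ i → Copy.copy (parameters i)) , λ i j same → index-injective i j
      (proj₂ (proj₂ scales) _ _ (same-c (parameters i) (parameters j) same))
      (proj₂ (proj₂ factors) _ _ (same-t (parameters i) (parameters j) same))
      (proj₂ (proj₂ translations) _ _ (same-d (parameters i) (parameters j) same))

  -- Assembly for primes other than 2 and 3.

  module _ (p≢2 : p ≢ 2) (p≢3 : p ≢ 3) (4≤q : 4 ℕ.≤ q) where

    2≉0 : 1# + 1# ≉ 0#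
    2≉0 eq = other-prime-≉0 prime[2] p≢2 (trans (+-congˡ (+-identityʳ 1#)) eq)

    3≉0 : 1# + 1# + 1# ≉ 0#
    3≉0 eq = other-prime-≉0 (from-yes (prime? 3)) p≢3
      (trans (+-congˡ (+-congˡ (+-identityʳ 1#))) (trans (sym (+-assoc 1# 1# 1#)) eq))

    -- This one bound yields both `18 < q³`, for the nine poles, and `24 ≤ q³`, for the excluded
    -- translations.
    64≤q³ : 64 ℕ.≤ q ^ 3
    64≤q³ = ℕₚ.^-monoˡ-≤ 3 4≤q

    open Trace (ℕₚ.≤-trans (ℕₚ.n≤1+n 3) 4≤q)
    open SixPoints.Points σ x y κ sx≈y sy≈z sκ≈κ κ²≈quad κ≉0 2≉0 3≉0

    configuration : Configuration σ
    configuration = Inversion.configuration σ point centre weight point-injective centre-injective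
      weight-≉0 s-weight norm-point 3≉0 (ℕₚ.≤-trans (ℕₚ.m≤m+n 19 45) 64≤q³)

    manyK46 : AtLeastK46 ((q ^ 3 ∸ 1) * (q ∸ 1) * (q ^ 3 ∸ 24))
    manyK46 = Counting.atLeastK46 configuration 2≉0 (ℕₚ.≤-trans (ℕₚ.m≤m+n 24 40) 64≤q³)

mainTheorem2 : (p k : ℕ) → Prime p → p ≢ 2 → p ≢ 3 → k ≥ 1 →
    (F : FiniteField ((p ^ k) ^ 3)) →
    NormGraph.AtLeastK46 (p ^ k) F (((p ^ k) ^ 3 ∸ 1) * ((p ^ k) ∸ 1) * ((p ^ k) ^ 3 ∸ 24))
mainTheorem2 p (suc k) p-prime p≢2 p≢3 (s≤s _) F =
  PrimePower.manyK46 p (suc k) p-prime F p≢2 p≢3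
    (ℕₚ.≤-trans 4≤p (ℕₚ.m≤m*n p (p ^ k) {{ℕₚ.m^n≢0 p k {{ℕ.>-nonZero (ℕₚ.≤-trans (s≤s z≤n) 4≤p)}}}}))
  where
  4≤p : 4 ℕ.≤ p
  4≤p = 4≤prime p-prime p≢2 p≢3
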